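{- Let $P=(X,\prec)$ be an interval order. A fundamental extender $S$ of $P$ is a Hilbert set if and only if $S$ is not the disjoint union of fundamental extenders that are proper subsets of $S$.
   Context: A finite (strictly) partially ordered set $P=(X,\prec)$, $X=\{1,\dots,n\}$, is an interval order if there are compact real intervals $[\ell_x,r_x]$, $x\in X$, with $\ell_x\le r_x$, such that $x\prec y$ if and only if $r_x<\ell_y$. Interval representations are moreover required to satisfy $r_x+1\le \ell_y$ for all $x\prec y$. A natural representation is one in which all endpoints are non-negative integers. The magnitude $m$ of $P$ is the number of distinct down-sets $D(z)=\{x: x\prec z\}$, $z\in X$. The canonical representation of $P$ is the (unique) natural representation whose set of interval endpoints is $\{0,1,\dots,m-1\}$. The length polyhedron $Q_P\subset\mathbb{R}^n$ is the set of all vectors $(r_x-\ell_x)_{x\in X}$ over all interval representations of $P$ with real endpoints (satisfying $r_x+1\le\ell_y$ for all $x\prec y$). Let $\boldsymbol{\rho^*}$ be the vector of interval lengths of the canonical representation. Then $Q_P=\boldsymbol{\rho^*}+Q_P^*$, where $Q_P^*=\{v-\boldsymbol{\rho^*}: v\in Q_P\}$ is a pointed rational cone. Let $[\ell_x,r_x]$, $x\in X$, now denote the intervals of the canonical representation. For $1\le i\le m-1$ the $i$th gap set is $\mathcal{G}_i=\{x\in X:\ell_x\le i-1\text{ and } i\le r_x\}$, and $\mathcal{G}_0=\mathcal{G}_m=\varnothing$. For $0\le i\le m$ the left- and right-borderline sets are $\mathcal{L}_i=\{x\in X: r_x=i-1\}$ and $\mathcal{R}_i=\{x\in X:\ell_x=i\}$.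 A non-empty set $S\subseteq X$ is a fundamental extender if there are an index $0\le i\le m$ and a set $Z$ with $Z\subseteq\mathcal{L}_i$ or $Z\subseteq\mathcal{R}_i$ such that $S=\mathcal{G}_i\cup Z$. $\mathcal{E}_P$ is the collection of all fundamental extenders. An integral Hilbert basis of a polyhedral cone is a finite set of integral vectors of the cone such that each integral vector in the cone is a non-negative integral linear combination of vectors from this set. A pointed rational cone has a unique (inclusion-)minimal integral Hilbert basis. For $Q_P^*$ it is contained in the set of characteristic vectors of the sets in $\mathcal{E}_P$. A set $S\subseteq X$ is a Hilbert set if $S\in\mathcal{E}_P$ and its characteristic vector belongs to the unique minimal integral Hilbert basis of $Q_P^*$. -}

module Defs where

open import Data.Bool.Base using (if_then_else_)
import Data.Bool.Properties as Bool
open import Data.Fin.Base using (Fin)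
open import Data.Fin.Subset using (Subset; _∪_; _∩_; ⋃; _⊆_; _⊂_; Nonempty; Empty)
open import Data.Integer.Base as ℤ using (ℤ; +_; 0ℤ; 1ℤ)
open import Data.List.Base as List using (List; []; _∷_)
import Data.List.Membership.Propositional as List
import Data.List.Relation.Binary.Subset.Propositional as List
open import Data.List.Relation.Unary.All using (All)
open import Data.List.Relation.Unary.AllPairs using (AllPairs)
open import Data.Nat.Base as ℕ using (ℕ; zero; suc)
import Data.Nat.Properties as ℕ
open import Data.Product.Base using (_×_; ∃-syntax; ∃₂)
open import Data.Rational.Base as ℚ using (ℚ; 0ℚ; 1ℚ; ½)
import Data.Rational.Properties as ℚ
open import Data.Rational.Solver using (module +-*-Solver)
open import Data.Sum.Base using (_⊎_)
open import Data.Vec.Base as Vec using (Vec)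
import Data.Vec.Properties as Vec
open import Function.Base using (_∘_)
open import Function.Bundles using (_⇔_)
open import Level using (0ℓ)
open import Relation.Binary.Core using (Rel)
open import Relation.Binary.Structures using (IsDecStrictPartialOrder)
open import Relation.Binary.PropositionalEquality using (_≡_; refl; sym; subst; subst₂)
open import Relation.Nullary.Decidable using (does; _×-dec_)
open import Relation.Unary using (Pred; Decidable)

-- Real numbers, as Cauchy sequences of rationals with a fixed modulus:
-- the n-th term is within 2⁻ⁿ of the limit.

2⁻ : ℕ → ℚ
2⁻ zero    = 1ℚ
2⁻ (suc n) = ½ ℚ.* 2⁻ n

record ℝ : Set where
  constructor mkℝ
  field
    seq     : ℕ → ℚ
    -- m and n are interchangeable, so this also bounds ∣ seq m - seq n ∣.
    regular : ∀ m n → seq m ℚ.- seq n ℚ.≤ 2⁻ m ℚ.+ 2⁻ n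

open ℝ public

infix  4 _≤_ _<_ _≃_
infixl 6 _+_ _-_
infix  8 -_

_≤_ : Rel ℝ 0ℓ
x ≤ y = ∀ n → seq x n ℚ.- seq y n ℚ.≤ 2⁻ n ℚ.+ 2⁻ n

_<_ : Rel ℝ 0ℓ
x < y = ∃[ n ] 2⁻ n ℚ.+ 2⁻ n ℚ.< seq y n ℚ.- seq x n

_≃_ : Rel ℝ 0ℓ
x ≃ y = x ≤ y × y ≤ x

private
  module Lemmas where
    open +-*-Solver

    interchange : ∀ a b c d → (a ℚ.- c) ℚ.+ (b ℚ.- d) ≡ (a ℚ.+ b) ℚ.- (c ℚ.+ d)
    interchange = solve 4 (λ a b c d → (a :- c) :+ (b :- d) := (a :+ b) :- (c :+ d)) refl

    halves : ∀ p q → (½ ℚ.* p ℚ.+ ½ ℚ.* q) ℚ.+ (½ ℚ.* p ℚ.+ ½ ℚ.* q) ≡ p ℚ.+ q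
    halves = solve 2 (λ p q →
      (con ½ :* p :+ con ½ :* q) :+ (con ½ :* p :+ con ½ :* q) := p :+ q) refl

    flip-neg : ∀ a b → b ℚ.- a ≡ (ℚ.- a) ℚ.- (ℚ.- b)
    flip-neg = solve 2 (λ a b → b :- a := (:- a) :- (:- b)) refl

  0≤2⁻ : ∀ n → 0ℚ ℚ.≤ 2⁻ n
  0≤2⁻ zero    = ℚ.nonNegative⁻¹ 1ℚ
  0≤2⁻ (suc n) = subst (ℚ._≤ ½ ℚ.* 2⁻ n) (ℚ.*-zeroʳ ½) (ℚ.*-monoˡ-≤-nonNeg ½ (0≤2⁻ n))

-- The index shift halves the error of each summand.
_+_ : ℝ → ℝ → ℝ
x + y = mkℝ (λ n → seq x (suc n) ℚ.+ seq y (suc n)) λ m n →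
  subst₂ ℚ._≤_
    (Lemmas.interchange (seq x (suc m)) (seq y (suc m)) (seq x (suc n)) (seq y (suc n)))
    (Lemmas.halves (2⁻ m) (2⁻ n))
    (ℚ.+-mono-≤ (regular x (suc m) (suc n)) (regular y (suc m) (suc n)))

-_ : ℝ → ℝ
- x = mkℝ (λ n → ℚ.- seq x n) λ m n →
  subst₂ ℚ._≤_
    (Lemmas.flip-neg (seq x m) (seq x n))
    (ℚ.+-comm (2⁻ n) (2⁻ m))
    (regular x n m)

_-_ : ℝ → ℝ → ℝ
x - y = x + (- y)

fromℚ : ℚ → ℝ
fromℚ q = mkℝ (λ _ → q) λ m n →
  subst (ℚ._≤ 2⁻ m ℚ.+ 2⁻ n) (sym (ℚ.+-inverseʳ q)) (ℚ.+-mono-≤ (0≤2⁻ m) (0≤2⁻ n))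

fromℤ : ℤ → ℝ
fromℤ z = fromℚ (z ℚ./ 1)

fromℕ : ℕ → ℝ
fromℕ k = fromℤ (+ k)

1ℝ : ℝ
1ℝ = fromℕ 1

record IntervalOrder (n : ℕ) : Set₁ where
  infix 4 _≺_
  field
    _≺_                     : Rel (Fin n) 0ℓ
    isDecStrictPartialOrder : IsDecStrictPartialOrder _≡_ _≺_
    intervals               : ∃₂ λ (ℓ r : Fin n → ℝ) →
                              (∀ x → ℓ x ≤ r x) × (∀ x y → x ≺ y ⇔ r x < ℓ y)

  open IsDecStrictPartialOrder isDecStrictPartialOrder public
    using () renaming (_<?_ to _≺?_)

⟦_⟧ : ∀ {n} {A : Pred (Fin n) 0ℓ} → Decidable A → Subset n
⟦ A? ⟧ = Vec.tabulate (does ∘ A?)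

ℝ^_ : ℕ → Set
ℝ^ n = Fin n → ℝ

lengths : ∀ {n} → (ℓ r : Fin n → ℝ) → ℝ^ n
lengths ℓ r x = r x - ℓ x

module _ {n : ℕ} (P : IntervalOrder n) where
  open IntervalOrder P

  downSet : Fin n → Subset n
  downSet z = ⟦ _≺? z ⟧

  magnitude : ℕ
  magnitude = List.length
    (List.deduplicate (Vec.≡-dec Bool._≟_) (List.map downSet (List.allFin n)))

  record IsRepresentation (ℓ r : Fin n → ℝ) : Set where
    field
      nonempty : ∀ x → ℓ x ≤ r x
      order    : ∀ x y → x ≺ y ⇔ r x < ℓ y
      gap      : ∀ x y → x ≺ y → r x + 1ℝ ≤ ℓ y

  record CanonicalRepresentation : Set where
    field
      ℓ r              : Fin n → ℕ
      isRepresentation : IsRepresentation (fromℕ ∘ ℓ) (fromℕ ∘ r)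
      endpoints        : ∀ k → (∃[ x ] (k ≡ ℓ x ⊎ k ≡ r x)) ⇔ k ℕ.< magnitude

  LengthPolyhedron : Pred (ℝ^ n) 0ℓ
  LengthPolyhedron v =
    ∃₂ λ ℓ r → IsRepresentation ℓ r × (∀ x → v x ≃ lengths ℓ r x)

-- A finite set of integral vectors is given by a
-- list; order and repetitions are irrelevant to all notions below.

module _ {n : ℕ} where
  combination : (Vec ℤ n → ℕ) → List (Vec ℤ n) → Vec ℤ n
  combination c []      = Vec.replicate n 0ℤ
  combination c (h ∷ H) =
    Vec.zipWith ℤ._+_ (Vec.map (+ c h ℤ.*_) h) (combination c H)

  module _ (K : Pred (ℝ^ n) 0ℓ) where

    IntegralPoint : Pred (Vec ℤ n) 0ℓ
    IntegralPoint z = K (λ x → fromℤ (Vec.lookup z x))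

    record IsHilbertBasis (H : List (Vec ℤ n)) : Set where
      field
        inCone    : All IntegralPoint H
        generates : ∀ z → IntegralPoint z → ∃[ c ] z ≡ combination c H

    record IsMinimalHilbertBasis (H : List (Vec ℤ n)) : Set where
      field
        isHilbertBasis : IsHilbertBasis H
        minimal        : ∀ H′ → IsHilbertBasis H′ → H′ List.⊆ H → H List.⊆ H′

characteristic : ∀ {n} → Subset n → Vec ℤ n
characteristic = Vec.map (λ b → if b then 1ℤ else 0ℤ)

module _ {n : ℕ} {P : IntervalOrder n} (C : CanonicalRepresentation P) where
  open CanonicalRepresentation C

  private
    m : ℕ
    m = magnitude P

  canonicalLengths : ℝ^ n
  canonicalLengths = lengths (fromℕ ∘ ℓ) (fromℕ ∘ r)

  LengthCone : Pred (ℝ^ n) 0ℓ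
  LengthCone w =
    ∃[ v ] LengthPolyhedron P v × (∀ x → w x ≃ v x - canonicalLengths x)

  -- The bounds on i make the sets for i = 0 and i = m empty.
  gapSet : ℕ → Subset n
  gapSet i = ⟦ (λ x → ((1 ℕ.≤? i) ×-dec (i ℕ.<? m)) ×-dec
                      ((ℓ x ℕ.≤? i ℕ.∸ 1) ×-dec (i ℕ.≤? r x))) ⟧

  -- r x = i - 1, without truncation at i = 0.
  leftBorderline : ℕ → Subset n
  leftBorderline i = ⟦ (λ x → suc (r x) ℕ.≟ i) ⟧

  rightBorderline : ℕ → Subset n
  rightBorderline i = ⟦ (λ x → ℓ x ℕ.≟ i) ⟧

  IsFundamentalExtender : Pred (Subset n) 0ℓ
  IsFundamentalExtender S = Nonempty S ×
    ∃₂ λ i Z → i ℕ.≤ m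
             × (Z ⊆ leftBorderline i ⊎ Z ⊆ rightBorderline i)
             × S ≡ gapSet i ∪ Z

  IsHilbertSet : Pred (Subset n) 0ℓ
  IsHilbertSet S = IsFundamentalExtender S ×
    ∃[ H ] IsMinimalHilbertBasis LengthCone H × characteristic S List.∈ H

  IsDisjointUnionOfProperExtenders : Pred (Subset n) 0ℓ
  IsDisjointUnionOfProperExtenders S =
    ∃[ Ts ] All (λ T → IsFundamentalExtender T × T ⊂ S) Ts
          × AllPairs (λ T T′ → Empty (T ∩ T′)) Ts
          × ⋃ Ts ≡ S

{-# OPTIONS --safe #-}
module Submission where

-- In the canonical representation every level 0, ..., m - 1 is both a left and a
-- right endpoint: down-sets are determined by left endpoints below m, and there
-- are m distinct ones (leftLevel, rightLevel). Therefore, in every representation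
-- the endpoints are ordered in blocks
--   left endpoints of level 0, right endpoints of level 0, left endpoints of
--   level 1, and so on,
-- with a distance of at least 1 after each block of right endpoints. Subtracting
-- the canonical endpoints removes these distances: the integral points of the
-- length cone are the vectors e - d, where the shifts d of the left and e of the
-- right endpoints are weakly increasing along the blocks (IsShift). Here a real
-- representation of an integral point is first rounded to an integral one
-- (rounding). A weakly increasing shift is a sum of 0/1-valued ones, which are
-- given by cuts of the block sequence, and the nonempty sets of intervals that
-- are met by a cut are exactly the fundamental extenders (cut⇒extender,
-- extender⇒cut). Consequently the vectors of fundamental extenders lie in the
-- cone, and every integral point of the cone is a sum of them (extender⇒cone,
-- cone⇒Span).
--
-- The rest is a statement about 0/1 vectors. All integral points of the cone are
-- non-negative, so a characteristic vector that is a sum of characteristic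
-- vectors comes from a disjoint union (Span⇒⋃). If S is a disjoint union of proper
-- subextenders, then its vector can be removed from any Hilbert basis, since the
-- vector of S cannot occur in a sum for a proper subset (Span-avoid). Conversely,
-- the extenders that are not such unions generate all others, by induction on
-- the size, and none of them can be omitted, so they form a minimal Hilbert
-- basis (indecomposables-minimal).

open import Defs
open import Data.Nat.Base using (ℕ)
open import Data.Fin.Subset using (Subset)
open import Function.Bundles using (_⇔_)
open import Relation.Nullary.Negation using (¬_)

open import Data.Bool.Base using (true; false; if_then_else_; _∨_)
import Data.Bool.Properties as Bool
open import Data.Fin.Base as Fin using (Fin; zero; suc)
import Data.Fin.Properties as Fin
open import Data.Fin.Subset
  using (inside; outside; _∈_; _∉_; _⊆_; _⊂_; _∪_; _∩_; ∁; ⋃; ⊥; Empty; Nonempty; ∣_∣)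
import Data.Fin.Subset.Properties as Subset
open import Data.Integer.Base as ℤ using (ℤ; +_; 0ℤ; 1ℤ)
import Data.Integer.DivMod as ℤ
import Data.Integer.Properties as ℤ
import Data.Integer.Solver as ℤSolver
open import Data.List.Base as List using (List; []; _∷_)
import Data.List.Membership.Propositional as List
import Data.List.Membership.Propositional.Properties as List
import Data.List.Relation.Binary.Subset.Propositional as List
open import Data.List.Relation.Unary.All as All using (All; []; _∷_)
open import Data.List.Relation.Unary.AllPairs as AllPairs using (AllPairs; []; _∷_)
open import Data.List.Relation.Unary.Any as Any using (here; there)
open import Data.List.Relation.Unary.Unique.DecPropositional.Properties using (deduplicate-!)
open import Data.List.Relation.Unary.Unique.Propositional using (Unique)
open import Data.Nat.Base as ℕ using (zero; suc)
import Data.Nat.Properties as ℕ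
open import Data.Product.Base using (_×_; _,_; proj₁; proj₂; ∃-syntax; ∃₂)
open import Data.Rational.Base as ℚ using (ℚ; 0ℚ; 1ℚ; ½)
import Data.Rational.Properties as ℚ
import Data.Rational.Solver as ℚSolver
open import Data.Rational.Unnormalised.Base as ℚᵘ using (mkℚᵘ; *≤*; *<*; *≡*)
import Data.Rational.Unnormalised.Properties as ℚᵘ
open import Data.Sum.Base as Sum using (_⊎_; inj₁; inj₂)
open import Data.Vec.Base as Vec using (Vec; []; _∷_; lookup)
import Data.Vec.Properties as Vec
open import Function.Base using (_∘_; id)
open import Function.Bundles using (mk⇔; module Equivalence)
open import Level using (0ℓ)
open import Relation.Binary.PropositionalEquality
  using (_≡_; _≢_; refl; sym; trans; cong; cong₂; subst; subst₂; module ≡-Reasoning)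
open import Relation.Binary.Structures using (IsDecStrictPartialOrder)
open import Relation.Nullary.Decidable
  using (Dec; yes; no; does; ¬?; map′; _×-dec_; _⊎-dec_; dec-true; decidable-stable; does-⇔)
open import Relation.Nullary.Negation using (contradiction)
open import Relation.Unary using (Pred; Decidable)

-- Integers within the rationals, and simultaneous rounding

-- The embedding of the integers into the rationals; a numeral real fromℤ z is
-- the constant sequence ι z.
ι : ℤ → ℚ
ι z = z ℚ./ 1

toℚᵘ-ι : ∀ z → ℚ.toℚᵘ (ι z) ℚᵘ.≃ mkℚᵘ z 0
toℚᵘ-ι z = ℚ.toℚᵘ-fromℚᵘ (mkℚᵘ z 0)

ι-≤ : ∀ {a b} → a ℤ.≤ b → ι a ℚ.≤ ι b
ι-≤ {a} {b} a≤b = ℚ.toℚᵘ-cancel-≤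
  (ℚᵘ.≤-respˡ-≃ (ℚᵘ.≃-sym (toℚᵘ-ι a)) (ℚᵘ.≤-respʳ-≃ (ℚᵘ.≃-sym (toℚᵘ-ι b))
    (*≤* (ℤ.*-monoʳ-≤-nonNeg 1ℤ a≤b))))

ι-cancel-< : ∀ {a b} → ι a ℚ.< ι b → a ℤ.< b
ι-cancel-< {a} {b} p = ℤ.≰⇒> λ b≤a → ℚ.<-irrefl refl (ℚ.<-≤-trans p (ι-≤ b≤a))

ι-+ : ∀ a b → ι (a ℤ.+ b) ≡ ι a ℚ.+ ι b
ι-+ a b = ℚ.toℚᵘ-injective (ℚᵘ.≃-trans (toℚᵘ-ι (a ℤ.+ b)) (ℚᵘ.≃-sym
  (ℚᵘ.≃-trans (ℚ.toℚᵘ-homo-+ (ι a) (ι b)) (ℚᵘ.≃-trans (ℚᵘ.+-cong (toℚᵘ-ι a) (toℚᵘ-ι b))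
    (*≡* (cong (ℤ._* 1ℤ) (cong₂ ℤ._+_ (ℤ.*-identityʳ a) (ℤ.*-identityʳ b))))))))

ι-* : ∀ a b → ι (a ℤ.* b) ≡ ι a ℚ.* ι b
ι-* a b = ℚ.toℚᵘ-injective (ℚᵘ.≃-trans (toℚᵘ-ι (a ℤ.* b)) (ℚᵘ.≃-sym
  (ℚᵘ.≃-trans (ℚ.toℚᵘ-homo-* (ι a) (ι b)) (ℚᵘ.*-cong (toℚᵘ-ι a) (toℚᵘ-ι b)))))

ι-neg : ∀ a → ι (ℤ.- a) ≡ ℚ.- ι a
ι-neg a = ℚ.toℚᵘ-injective (ℚᵘ.≃-trans (toℚᵘ-ι (ℤ.- a)) (ℚᵘ.≃-sym
  (ℚᵘ.≃-trans (ℚ.toℚᵘ-homo‿- (ι a)) (ℚᵘ.-‿cong (toℚᵘ-ι a)))))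

floor-≤ : ∀ q → ι (ℚ.floor q) ℚ.≤ q
floor-≤ q@record{} = ℚ.toℚᵘ-cancel-≤ (ℚᵘ.≤-respˡ-≃ (ℚᵘ.≃-sym (toℚᵘ-ι (ℚ.floor q)))
  (*≤* (subst (ℚ.floor q ℤ.* ℚ.↧ q ℤ.≤_) (sym (ℤ.*-identityʳ (ℚ.↥ q))) (ℤ.[n/d]*d≤n (ℚ.↥ q) (ℚ.↧ q)))))

<-suc-floor : ∀ q → q ℚ.< ι (ℚ.floor q) ℚ.+ 1ℚ
<-suc-floor q@record{} = subst (q ℚ.<_) (trans (ι-+ 1ℤ (ℚ.floor q)) (ℚ.+-comm 1ℚ (ι (ℚ.floor q))))
  (ℚ.toℚᵘ-cancel-< (ℚᵘ.<-respʳ-≃ (ℚᵘ.≃-sym (toℚᵘ-ι (ℤ.suc (ℚ.floor q))))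
  (*<* (subst₂ ℤ._<_ (sym (ℤ.*-identityʳ (ℚ.↥ q)))
     (cong (λ k → ℤ.suc k ℤ.* ℚ.↧ q) (sym (ℤ.div-pos-is-/ℕ (ℚ.↥ q) (suc (ℚ.denominator-1 q)))))
     (ℤ.n<s[n/ℕd]*d (ℚ.↥ q) (suc (ℚ.denominator-1 q)))))))

2⁻-nonNeg : ∀ n → 0ℚ ℚ.≤ 2⁻ n
2⁻-nonNeg zero    = ℚ.nonNegative⁻¹ 1ℚ
2⁻-nonNeg (suc n) = subst (ℚ._≤ ½ ℚ.* 2⁻ n) (ℚ.*-zeroʳ ½) (ℚ.*-monoˡ-≤-nonNeg ½ (2⁻-nonNeg n))

-- An error of 2⁻ n is at most one unit after scaling by n + 1.
scaled-2⁻ : ∀ n → ι (+ suc n) ℚ.* 2⁻ n ℚ.≤ 1ℚ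
scaled-2⁻ zero    = ℚ.≤-refl
scaled-2⁻ (suc n) = ℚ.≤-trans (ℚ.≤-reflexive eq)
  (ℚ.*-monoˡ-≤-nonNeg ½ (ℚ.+-mono-≤ (scaled-2⁻ n) (ℚ.≤-trans 2⁻≤ (scaled-2⁻ n))))
  where
  open ℚSolver.+-*-Solver
  2⁻≤ : 2⁻ n ℚ.≤ ι (+ suc n) ℚ.* 2⁻ n
  2⁻≤ = subst (ℚ._≤ ι (+ suc n) ℚ.* 2⁻ n) (ℚ.*-identityˡ (2⁻ n))
    (ℚ.*-monoʳ-≤-nonNeg (2⁻ n) {{ℚ.nonNegative (2⁻-nonNeg n)}} (ι-≤ {1ℤ} {+ suc n} (ℤ.+≤+ (ℕ.s≤s ℕ.z≤n))))
  eq : ι (+ suc (suc n)) ℚ.* (½ ℚ.* 2⁻ n) ≡ ½ ℚ.* (ι (+ suc n) ℚ.* 2⁻ n ℚ.+ 2⁻ n)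
  eq = trans (cong (ℚ._* (½ ℚ.* 2⁻ n)) (ι-+ 1ℤ (+ suc n)))
    (solve 2 (λ k t → (con 1ℚ :+ k) :* (con ½ :* t) := con ½ :* (k :* t :+ t)) refl (ι (+ suc n)) (2⁻ n))

p≤q⇒p-q≤0 : ∀ {p q} → p ℚ.≤ q → p ℚ.- q ℚ.≤ 0ℚ
p≤q⇒p-q≤0 {p} {q} p≤q = subst (p ℚ.- q ℚ.≤_) (ℚ.+-inverseʳ q) (ℚ.+-monoˡ-≤ (ℚ.- q) p≤q)

module _ (n : ℕ) where

  -- Floor division by n + 1.
  div : ℤ → ℤ
  div a = a ℤ./ℕ suc n

  div-≤ : ∀ a b c → a ℤ.≤ b ℤ.+ c ℤ.* + suc n → div a ℤ.≤ div b ℤ.+ c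
  div-≤ a b c a≤ = ℤ.≮⇒≥ λ l → ℤ.<-irrefl refl (begin-strict
    ℤ.suc (div b ℤ.+ c) ℤ.* + suc n            ≤⟨ ℤ.*-monoʳ-≤-nonNeg (+ suc n) (ℤ.i<j⇒suc[i]≤j l) ⟩
    div a ℤ.* + suc n                          ≤⟨ ℤ.[n/ℕd]*d≤n a (suc n) ⟩
    a                                          ≤⟨ a≤ ⟩
    b ℤ.+ c ℤ.* + suc n                        <⟨ ℤ.+-monoˡ-< (c ℤ.* + suc n) (ℤ.n<s[n/ℕd]*d b (suc n)) ⟩
    ℤ.suc (div b) ℤ.* + suc n ℤ.+ c ℤ.* + suc n ≡⟨ ℤ.*-distribʳ-+ (+ suc n) (ℤ.suc (div b)) c ⟨
    (ℤ.suc (div b) ℤ.+ c) ℤ.* + suc n          ≡⟨ cong (ℤ._* + suc n) (ℤ.+-assoc 1ℤ (div b) c) ⟩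
    ℤ.suc (div b ℤ.+ c) ℤ.* + suc n            ∎)
    where open ℤ.≤-Reasoning

  div-mono : ∀ {a b} → a ℤ.≤ b → div a ℤ.≤ div b
  div-mono {a} {b} a≤b = subst (div a ℤ.≤_) (ℤ.+-identityʳ (div b))
    (div-≤ a b 0ℤ (subst (a ℤ.≤_) (sym (ℤ.+-identityʳ b)) a≤b))

  -- The quotient increases between the shifts k and k + 1 of a. Among n + 1
  -- consecutive shifts this happens at most once.
  Jump : ℤ → ℕ → Set
  Jump a k = div (a ℤ.+ + k) ℤ.< div (a ℤ.+ + suc k)

  jump-unique : ∀ a {k k′} → k ℕ.< k′ → k′ ℕ.≤ n → Jump a k → ¬ Jump a k′
  jump-unique a {k} {k′} k<k′ k′≤n j j′ = ℤ.<-irrefl refl (begin-strict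
    div (a ℤ.+ + k)              <⟨ j ⟩
    div (a ℤ.+ + suc k)          ≤⟨ div-mono (ℤ.+-monoʳ-≤ a (ℤ.+≤+ k<k′)) ⟩
    div (a ℤ.+ + k′)             ≤⟨ ℤ.i<j⇒i≤pred[j] j′ ⟩
    ℤ.pred (div (a ℤ.+ + suc k′)) ≤⟨ ℤ.pred-mono (div-≤ (a ℤ.+ + suc k′) (a ℤ.+ + k) 1ℤ a+k′≤) ⟩
    ℤ.pred (div (a ℤ.+ + k) ℤ.+ 1ℤ) ≡⟨ cong ℤ.pred (ℤ.+-comm (div (a ℤ.+ + k)) 1ℤ) ⟩
    ℤ.pred (ℤ.suc (div (a ℤ.+ + k))) ≡⟨ ℤ.pred-suc (div (a ℤ.+ + k)) ⟩
    div (a ℤ.+ + k) ∎)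
    where
    open ℤ.≤-Reasoning
    a+k′≤ : a ℤ.+ + suc k′ ℤ.≤ a ℤ.+ + k ℤ.+ 1ℤ ℤ.* + suc n
    a+k′≤ = begin
      a ℤ.+ + suc k′ ≤⟨ ℤ.+-monoʳ-≤ a (ℤ.+≤+ (ℕ.≤-trans (ℕ.s≤s k′≤n) (ℕ.m≤n+m (suc n) k))) ⟩
      a ℤ.+ (+ k ℤ.+ + suc n) ≡⟨ ℤ.+-assoc a (+ k) (+ suc n) ⟨
      a ℤ.+ + k ℤ.+ + suc n ≡⟨ cong (λ m → a ℤ.+ + k ℤ.+ m) (ℤ.*-identityˡ (+ suc n)) ⟨
      a ℤ.+ + k ℤ.+ 1ℤ ℤ.* + suc n ∎

  jump? : ∀ a k → Dec (Jump a k)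
  jump? a k = div (a ℤ.+ + k) ℤ.<? div (a ℤ.+ + suc k)

  -- By pigeonhole, n integers have a common shift in 0, ..., n at which no quotient
  -- increases.
  goodShift : (A : Fin n → ℤ) → ∃[ k ] ∀ y → ¬ Jump (A y) k
  goodShift A with Fin.any? {n = suc n} (λ k → Fin.all? λ y → ¬? (jump? (A y) (Fin.toℕ k)))
  ... | yes (k , good) = Fin.toℕ k , good
  ... | no  none       = contradiction (Fin.pigeonhole (ℕ.n<1+n n) (proj₁ ∘ bad)) λ
    { (k , k′ , k<k′ , eq) → jump-unique (A (proj₁ (bad k))) k<k′ (Fin.toℕ≤pred[n] k′)
        (proj₂ (bad k)) (subst (λ y → Jump (A y) (Fin.toℕ k′)) (sym eq) (proj₂ (bad k′))) }
    where
    bad : ∀ k → ∃[ y ] Jump (A y) (Fin.toℕ k)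
    bad k with Fin.any? (λ y → jump? (A y) (Fin.toℕ k))
    ... | yes p = p
    ... | no ¬p = contradiction (k , λ y j → ¬p (y , j)) none

  -- Simultaneous rounding of n rationals that turns every difference bound with
  -- an integer constant, even if it holds only up to 2⁻ n, into an exact one.
  -- Each q x is scaled by n + 1, rounded down, shifted by a common good shift and
  -- divided by n + 1. Scaling makes the error at most 1, and a good shift absorbs
  -- a difference of 1.
  rounding : (q : Fin n → ℚ) → ∃[ a ] ∀ x y c →
             q y ℚ.- q x ℚ.≤ ι c ℚ.+ 2⁻ n → a y ℤ.≤ a x ℤ.+ c
  rounding q = (λ x → div (A x ℤ.+ + k)) , λ x y c y-x≤ →
    ℤ.≤-trans (div-≤ (A y ℤ.+ + k) (A x ℤ.+ + suc k) c
                (shifted x y c (ℤ.i<j⇒i≤pred[j] (ι-cancel-<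
                  {A y} {ℤ.suc (ℤ.suc (c ℤ.* + suc n ℤ.+ A x))} (bound x y c y-x≤)))))
              (ℤ.+-monoˡ-≤ c (ℤ.≮⇒≥ (good x)))
    where
    A : Fin n → ℤ
    A x = ℚ.floor (ι (+ suc n) ℚ.* q x)
    k = proj₁ (goodShift A)
    good = proj₂ (goodShift A)

    bound : ∀ x y c → q y ℚ.- q x ℚ.≤ ι c ℚ.+ 2⁻ n → ι (A y) ℚ.< ι (ℤ.suc (ℤ.suc (c ℤ.* + suc n ℤ.+ A x)))
    bound x y c y-x≤ = begin-strict
      ι (A y)  ≤⟨ floor-≤ (K ℚ.* q y) ⟩
      K ℚ.* q y ≡⟨ solve 3 (λ K a b → K :* a := K :* (a :- b) :+ K :* b) refl K (q y) (q x) ⟩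
      K ℚ.* (q y ℚ.- q x) ℚ.+ K ℚ.* q x
        ≤⟨ ℚ.+-monoˡ-≤ (K ℚ.* q x) (ℚ.*-monoˡ-≤-nonNeg K
              {{ℚ.nonNegative (ι-≤ {0ℤ} {+ suc n} (ℤ.+≤+ ℕ.z≤n))}} y-x≤) ⟩
      K ℚ.* (ι c ℚ.+ 2⁻ n) ℚ.+ K ℚ.* q x
        ≡⟨ solve 4 (λ K c e b → K :* (c :+ e) :+ b := K :* e :+ (c :* K :+ b)) refl K (ι c) (2⁻ n) (K ℚ.* q x) ⟩
      K ℚ.* 2⁻ n ℚ.+ (ι c ℚ.* K ℚ.+ K ℚ.* q x) ≤⟨ ℚ.+-monoˡ-≤ (ι c ℚ.* K ℚ.+ K ℚ.* q x) (scaled-2⁻ n) ⟩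
      1ℚ ℚ.+ (ι c ℚ.* K ℚ.+ K ℚ.* q x)  <⟨ ℚ.+-monoʳ-< 1ℚ (ℚ.+-monoʳ-< (ι c ℚ.* K) (<-suc-floor (K ℚ.* q x))) ⟩
      1ℚ ℚ.+ (ι c ℚ.* K ℚ.+ (ι (A x) ℚ.+ 1ℚ))
        ≡⟨ solve 2 (λ c a → con 1ℚ :+ (c :+ (a :+ con 1ℚ)) := con 1ℚ :+ (con 1ℚ :+ (c :+ a))) refl (ι c ℚ.* K) (ι (A x)) ⟩
      1ℚ ℚ.+ (1ℚ ℚ.+ (ι c ℚ.* K ℚ.+ ι (A x))) ≡⟨ cong (λ p → 1ℚ ℚ.+ (1ℚ ℚ.+ (p ℚ.+ ι (A x)))) (ι-* c (+ suc n)) ⟨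
      1ℚ ℚ.+ (1ℚ ℚ.+ (ι (c ℤ.* + suc n) ℚ.+ ι (A x))) ≡⟨ cong (λ p → 1ℚ ℚ.+ (1ℚ ℚ.+ p)) (ι-+ (c ℤ.* + suc n) (A x)) ⟨
      1ℚ ℚ.+ (1ℚ ℚ.+ ι (c ℤ.* + suc n ℤ.+ A x)) ≡⟨ cong (1ℚ ℚ.+_) (ι-+ 1ℤ (c ℤ.* + suc n ℤ.+ A x)) ⟨
      1ℚ ℚ.+ ι (ℤ.suc (c ℤ.* + suc n ℤ.+ A x)) ≡⟨ ι-+ 1ℤ (ℤ.suc (c ℤ.* + suc n ℤ.+ A x)) ⟨
      ι (ℤ.suc (ℤ.suc (c ℤ.* + suc n ℤ.+ A x))) ∎
      where
      open ℚ.≤-Reasoning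
      open ℚSolver.+-*-Solver
      K = ι (+ suc n)

    shifted : ∀ x y c → A y ℤ.≤ ℤ.pred (ℤ.suc (ℤ.suc (c ℤ.* + suc n ℤ.+ A x))) →
              A y ℤ.+ + k ℤ.≤ A x ℤ.+ + suc k ℤ.+ c ℤ.* + suc n
    shifted x y c le = ℤ.≤-trans (ℤ.+-monoˡ-≤ (+ k) le) (ℤ.≤-reflexive
      (solve 3 (λ a c k → con (ℤ.- 1ℤ) :+ (con 1ℤ :+ (con 1ℤ :+ (c :+ a))) :+ k
                       := a :+ (con 1ℤ :+ k) :+ c) refl (A x) (c ℤ.* + suc n) (+ k)))
      where open ℤSolver.+-*-Solver

-- Sums of generators and integral combinations

module _ {n : ℕ} where

  infixr 6 _⊕_

  _⊕_ : Vec ℤ n → Vec ℤ n → Vec ℤ n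
  _⊕_ = Vec.zipWith ℤ._+_

  𝟎 : Vec ℤ n
  𝟎 = Vec.replicate n 0ℤ

  ⊕-assoc : ∀ u v w → (u ⊕ v) ⊕ w ≡ u ⊕ (v ⊕ w)
  ⊕-assoc = Vec.zipWith-assoc ℤ.+-assoc

  ⊕-comm : ∀ u v → u ⊕ v ≡ v ⊕ u
  ⊕-comm = Vec.zipWith-comm ℤ.+-comm

  ⊕-identityˡ : ∀ v → 𝟎 ⊕ v ≡ v
  ⊕-identityˡ = Vec.zipWith-identityˡ ℤ.+-identityˡ

  ⊕-identityʳ : ∀ v → v ⊕ 𝟎 ≡ v
  ⊕-identityʳ = Vec.zipWith-identityʳ ℤ.+-identityʳ

  lookup-ext : ∀ {A : Set} {u v : Vec A n} → (∀ x → lookup u x ≡ lookup v x) → u ≡ v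
  lookup-ext {u = u} {v} eq = trans (sym (Vec.tabulate∘lookup u))
    (trans (Vec.tabulate-cong eq) (Vec.tabulate∘lookup v))

  -- All finite sums of members of H, with repetition. Unlike combination, this
  -- depends only on which vectors are generators, not on how often a list repeats
  -- them.
  data Span (H : Pred (Vec ℤ n) 0ℓ) : Pred (Vec ℤ n) 0ℓ where
    []  : Span H 𝟎
    _∷_ : ∀ {h z} → H h → Span H z → Span H (h ⊕ z)

  module _ {H : Pred (Vec ℤ n) 0ℓ} where

    Span-single : ∀ {h} → H h → Span H h
    Span-single {h} h∈H = subst (Span H) (⊕-identityʳ h) (h∈H ∷ [])

    Span-⊕ : ∀ {u v} → Span H u → Span H v → Span H (u ⊕ v)
    Span-⊕ {v = v} []  q = subst (Span H) (sym (⊕-identityˡ v)) q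
    Span-⊕ {v = v} (_∷_ {h} {z} h∈H p) q =
      subst (Span H) (sym (⊕-assoc h z v)) (h∈H ∷ Span-⊕ p q)

  Span-bind : ∀ {G H : Pred (Vec ℤ n) 0ℓ} → (∀ {h} → G h → Span H h) →
              ∀ {z} → Span G z → Span H z
  Span-bind f []        = []
  Span-bind f (h∈G ∷ p) = Span-⊕ (f h∈G) (Span-bind f p)

  -- Span is closed under natural multiples.
  multiple : ∀ {H : Pred (Vec ℤ n) 0ℓ} k {h} → Span H h → Span H (Vec.map (+ k ℤ.*_) h)
  multiple {H} zero {h} p = subst (Span H) (sym (Vec.map-const h 0ℤ)) []
  multiple {H} (suc k) {h} p = subst (Span H) (lookup-ext eq) (Span-⊕ p (multiple k p))
    where
    eq : ∀ x → lookup (h ⊕ Vec.map (+ k ℤ.*_) h) x ≡ lookup (Vec.map (+ suc k ℤ.*_) h) x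
    eq x rewrite Vec.lookup-zipWith ℤ._+_ x h (Vec.map (+ k ℤ.*_) h)
               | Vec.lookup-map x (+ k ℤ.*_) h | Vec.lookup-map x (+ suc k ℤ.*_) h
               = sym (ℤ.suc-* (+ k) (lookup h x))

  combination⇒Span : ∀ c H → Span (List._∈ H) (combination c H)
  combination⇒Span c []      = []
  combination⇒Span c (h ∷ H) = Span-⊕
    (multiple (c h) (Span-single (here refl)))
    (Span-bind (Span-single ∘ there) (combination⇒Span c H))

  _≟ᵛ_ : (u v : Vec ℤ n) → Dec (u ≡ v)
  _≟ᵛ_ = Vec.≡-dec ℤ._≟_

  -- The coefficient function c with the coefficient of h raised by one.
  increment : Vec ℤ n → (Vec ℤ n → ℕ) → Vec ℤ n → ℕ
  increment h c g with g ≟ᵛ h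
  ... | yes _ = suc (c g)
  ... | no  _ = c g

  combination-0 : ∀ H → combination (λ _ → 0) H ≡ 𝟎
  combination-0 []      = refl
  combination-0 (h ∷ H) = trans (cong₂ _⊕_ (Vec.map-const h 0ℤ) (combination-0 H)) (⊕-identityˡ 𝟎)

  combination-increment-∉ : ∀ {h} c H → All (h ≢_) H → combination (increment h c) H ≡ combination c H
  combination-increment-∉ c []      _ = refl
  combination-increment-∉ {h} c (g ∷ H) (h≢g ∷ h∉H) with g ≟ᵛ h
  ... | yes refl = contradiction refl h≢g
  ... | no _ = cong (Vec.map (+ c g ℤ.*_) g ⊕_) (combination-increment-∉ c H h∉H)

  combination-increment-∈ : ∀ {h} c H → Unique H → h List.∈ H →
                            combination (increment h c) H ≡ h ⊕ combination c H
  combination-increment-∈ {h} c (g ∷ H) (g∉H ∷ !H) h∈ with g ≟ᵛ h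
  combination-increment-∈ {h} c (g ∷ H) (g∉H ∷ !H) h∈ | yes refl =
    trans (cong₂ _⊕_ eq (combination-increment-∉ c H g∉H)) (⊕-assoc h _ _)
    where
    eq : Vec.map (+ suc (c h) ℤ.*_) h ≡ h ⊕ Vec.map (+ c h ℤ.*_) h
    eq = lookup-ext λ x → trans (Vec.lookup-map x _ h) (trans (ℤ.suc-* (+ c h) (lookup h x))
      (sym (trans (Vec.lookup-zipWith ℤ._+_ x h _) (cong (ℤ._+_ (lookup h x)) (Vec.lookup-map x _ h)))))
  combination-increment-∈ {h} c (g ∷ H) (g∉H ∷ !H) (here refl) | no g≢h = contradiction refl g≢h
  combination-increment-∈ {h} c (g ∷ H) (g∉H ∷ !H) (there h∈H) | no g≢h = begin
    cg ⊕ combination (increment h c) H ≡⟨ cong (cg ⊕_) (combination-increment-∈ c H !H h∈H) ⟩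
    cg ⊕ h ⊕ combination c H           ≡⟨ ⊕-assoc cg h _ ⟨
    (cg ⊕ h) ⊕ combination c H         ≡⟨ cong (_⊕ combination c H) (⊕-comm cg h) ⟩
    (h ⊕ cg) ⊕ combination c H         ≡⟨ ⊕-assoc h cg _ ⟩
    h ⊕ cg ⊕ combination c H           ∎
    where
    open ≡-Reasoning
    cg = Vec.map (+ c g ℤ.*_) g

  -- Uniqueness is needed: a coefficient function gives all occurrences of a
  -- vector the same coefficient, so a vector that is listed twice contributes
  -- only its even multiples.
  Span⇒combination : ∀ {H} → Unique H → ∀ {z} → Span (List._∈ H) z → ∃[ c ] z ≡ combination c H
  Span⇒combination {H} !H []        = (λ _ → 0) , sym (combination-0 H)
  Span⇒combination {H} !H (_∷_ {h} h∈H p) with Span⇒combination !H p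
  ... | c , refl = increment h c , sym (combination-increment-∈ c H !H h∈H)

  -- Non-negative in every coordinate.
  NonNeg : Pred (Vec ℤ n) 0ℓ
  NonNeg z = ∀ x → 0ℤ ℤ.≤ lookup z x

  Span-nonNeg : ∀ {H : Pred (Vec ℤ n) 0ℓ} → (∀ {h} → H h → NonNeg h) → ∀ {z} → Span H z → NonNeg z
  Span-nonNeg H≥0 []                    x = ℤ.≤-reflexive (sym (Vec.lookup-replicate x 0ℤ))
  Span-nonNeg H≥0 (_∷_ {h} {z} h∈H p) x = subst (0ℤ ℤ.≤_) (sym (Vec.lookup-zipWith ℤ._+_ x h z))
    (ℤ.+-mono-≤ (H≥0 h∈H x) (Span-nonNeg H≥0 p x))

  -- Over non-negative generators, a vector that is smaller than s in some
  -- coordinate is a sum without s: every summand is bounded by the sum.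
  Span-avoid : ∀ {H : Pred (Vec ℤ n) 0ℓ} → (∀ {h} → H h → NonNeg h) → ∀ {s z} x →
               lookup z x ℤ.< lookup s x → Span H z → Span (λ h → H h × h ≢ s) z
  Span-avoid H≥0 x z<s [] = []
  Span-avoid H≥0 {s} x z<s (_∷_ {h} {z} h∈H p) =
    (h∈H , λ { refl → ℤ.<-irrefl refl (ℤ.≤-<-trans h≤ z<s) }) ∷ Span-avoid H≥0 x (ℤ.≤-<-trans z≤ z<s) p
    where
    h≤ : lookup h x ℤ.≤ lookup (h ⊕ z) x
    h≤ = subst₂ ℤ._≤_ (ℤ.+-identityʳ _) (sym (Vec.lookup-zipWith ℤ._+_ x h z))
      (ℤ.+-monoʳ-≤ (lookup h x) (Span-nonNeg H≥0 p x))
    z≤ : lookup z x ℤ.≤ lookup (h ⊕ z) x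
    z≤ = subst₂ ℤ._≤_ (ℤ.+-identityˡ _) (sym (Vec.lookup-zipWith ℤ._+_ x h z))
      (ℤ.+-monoˡ-≤ (lookup z x) (H≥0 h∈H x))

-- Characteristic vectors and disjoint unions

𝟙 : ∀ {n} → Subset n → Vec ℤ n
𝟙 = characteristic

𝟙-nonNeg : ∀ {n} (S : Subset n) → NonNeg (𝟙 S)
𝟙-nonNeg (true  ∷ S) zero    = ℤ.+≤+ ℕ.z≤n
𝟙-nonNeg (false ∷ S) zero    = ℤ.+≤+ ℕ.z≤n
𝟙-nonNeg (_ ∷ S)     (suc x) = 𝟙-nonNeg S x

lookup-𝟙-∈ : ∀ {n x} {S : Subset n} → x ∈ S → lookup (𝟙 S) x ≡ 1ℤ
lookup-𝟙-∈ {x = x} {S} x∈S = trans (Vec.lookup-map x _ S) (cong (if_then 1ℤ else 0ℤ) (Vec.[]=⇒lookup x∈S))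

∉⇒lookup : ∀ {n x} {S : Subset n} → x ∉ S → lookup S x ≡ outside
∉⇒lookup {x = x} {S} x∉S = Bool.¬-not (x∉S ∘ Vec.lookup⇒[]= x S)

lookup-𝟙-∉ : ∀ {n x} {S : Subset n} → x ∉ S → lookup (𝟙 S) x ≡ 0ℤ
lookup-𝟙-∉ {x = x} {S} x∉S = trans (Vec.lookup-map x _ S) (cong (if_then 1ℤ else 0ℤ) (∉⇒lookup x∉S))

𝟙-injective : ∀ {n} {S T : Subset n} → 𝟙 S ≡ 𝟙 T → S ≡ T
𝟙-injective {S = S} {T} eq = Subset.⊆-antisym (incl S T eq) (incl T S (sym eq))
  where
  incl : ∀ {n} (S T : Subset n) → 𝟙 S ≡ 𝟙 T → S ⊆ T
  incl S T eq {x} x∈S with x Subset.∈? T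
  ... | yes x∈T = x∈T
  ... | no  x∉T with () ← trans (sym (lookup-𝟙-∈ x∈S)) (trans (cong (λ v → lookup v x) eq) (lookup-𝟙-∉ x∉T))

𝟙-⊥ : ∀ {n} → 𝟙 ⊥ ≡ 𝟎 {n}
𝟙-⊥ {n} = Vec.map-replicate _ outside n

𝟙-∪ : ∀ {n} (S T : Subset n) → Empty (S ∩ T) → 𝟙 (S ∪ T) ≡ 𝟙 S ⊕ 𝟙 T
𝟙-∪ []            []            _   = refl
𝟙-∪ (inside  ∷ S) (inside  ∷ T) dis = contradiction (zero , Vec.here) dis
𝟙-∪ (inside  ∷ S) (outside ∷ T) dis = cong (1ℤ ∷_) (𝟙-∪ S T (Subset.drop-∷-Empty dis))
𝟙-∪ (outside ∷ S) (inside  ∷ T) dis = cong (1ℤ ∷_) (𝟙-∪ S T (Subset.drop-∷-Empty dis))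
𝟙-∪ (outside ∷ S) (outside ∷ T) dis = cong (0ℤ ∷_) (𝟙-∪ S T (Subset.drop-∷-Empty dis))

⊆⋃ : ∀ {n T} {Ts : List (Subset n)} → T List.∈ Ts → T ⊆ ⋃ Ts
⊆⋃ (here refl)  = Subset.p⊆p∪q _
⊆⋃ {Ts = U ∷ Ts} (there T∈Ts) = Subset.q⊆p∪q U _ ∘ ⊆⋃ T∈Ts

∈⋃⁻ : ∀ {n x} (Ts : List (Subset n)) → x ∈ ⋃ Ts → ∃[ T ] T List.∈ Ts × x ∈ T
∈⋃⁻ []       x∈ = contradiction x∈ Subset.∉⊥
∈⋃⁻ (T ∷ Ts) x∈ with Subset.x∈p∪q⁻ T (⋃ Ts) x∈
... | inj₁ x∈T = T , here refl , x∈T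
... | inj₂ x∈⋃ with ∈⋃⁻ Ts x∈⋃
...   | U , U∈Ts , x∈U = U , there U∈Ts , x∈U

Disjoint : ∀ {n} → Subset n → Subset n → Set
Disjoint S T = Empty (S ∩ T)

disjoint-⋃ : ∀ {n} {T : Subset n} {Ts} → All (Disjoint T) Ts → Disjoint T (⋃ Ts)
disjoint-⋃ {T = T} {Ts} dis (x , x∈) with Subset.x∈p∩q⁻ T (⋃ Ts) x∈
... | x∈T , x∈⋃ with ∈⋃⁻ Ts x∈⋃
...   | U , U∈Ts , x∈U = All.lookup dis U∈Ts (x , Subset.x∈p∩q⁺ (x∈T , x∈U))

Span-𝟙-⋃ : ∀ {n} {H : Pred (Vec ℤ n) 0ℓ} {Ts} → All (Span H ∘ 𝟙) Ts → AllPairs Disjoint Ts → Span H (𝟙 (⋃ Ts))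
Span-𝟙-⋃ {H = H} []       []       = subst (Span H) (sym 𝟙-⊥) []
Span-𝟙-⋃ {H = H} {T ∷ Ts} (p ∷ ps) (d ∷ ds) =
  subst (Span H) (sym (𝟙-∪ T (⋃ Ts) (disjoint-⋃ d))) (Span-⊕ p (Span-𝟙-⋃ ps ds))

-- If a characteristic vector exceeds another one by a non-negative vector, then
-- the difference is the characteristic vector of a complement.
split-𝟙 : ∀ {n} (U T : Subset n) z → NonNeg z → 𝟙 U ⊕ z ≡ 𝟙 T →
          ∃[ T′ ] z ≡ 𝟙 T′ × Disjoint U T′ × U ∪ T′ ≡ T
split-𝟙 []      []      []      _   _  = [] , refl , (λ ()) , refl
split-𝟙 (u ∷ U) (t ∷ T) (i ∷ z) z≥0 eq with split-𝟙 U T z (z≥0 ∘ suc) (Vec.∷-injectiveʳ eq)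
... | T′ , z≡ , dis , ∪≡ with head u t i (z≥0 zero) (Vec.∷-injectiveˡ eq)
  where
  head : ∀ u t i → 0ℤ ℤ.≤ i → (if u then 1ℤ else 0ℤ) ℤ.+ i ≡ (if t then 1ℤ else 0ℤ) →
         ∃[ t′ ] i ≡ (if t′ then 1ℤ else 0ℤ) × ¬ (u ≡ inside × t′ ≡ inside) × (u ∨ t′) ≡ t
  head false t i _ eq = t , trans (sym (ℤ.+-identityˡ i)) eq , (λ { (() , _) }) , refl
  head true true  (+ zero)  _ eq = false , refl , (λ { (_ , ()) }) , refl
  head true true  (+ suc _) _ ()
  head true false (+ _)     _ ()
... | t′ , i≡ , ¬both , ∨≡ = t′ ∷ T′ , cong₂ _∷_ i≡ z≡ , dis′ , cong₂ _∷_ ∨≡ ∪≡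
  where
  dis′ : Disjoint (u ∷ U) (t′ ∷ T′)
  dis′ (x , x∈) with Subset.x∈p∩q⁻ (u ∷ U) (t′ ∷ T′) x∈
  dis′ (zero  , _) | Vec.here , Vec.here = ¬both (refl , refl)
  dis′ (suc x , _) | Vec.there x∈U , Vec.there x∈T′ = dis (x , Subset.x∈p∩q⁺ (x∈U , x∈T′))

-- A characteristic vector that is a sum of characteristic vectors comes from a
-- disjoint union.
Span⇒⋃ : ∀ {n} {E : Pred (Subset n) 0ℓ} {T z} → Span (λ h → ∃[ U ] E U × h ≡ 𝟙 U) z → z ≡ 𝟙 T →
         ∃[ Ts ] All E Ts × AllPairs Disjoint Ts × ⋃ Ts ≡ T
Span⇒⋃ [] eq = [] , [] , [] , 𝟙-injective (trans 𝟙-⊥ eq)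
Span⇒⋃ {T = T} (_∷_ {z = z} (U , U∈E , refl) p) eq
  with split-𝟙 U T z (Span-nonNeg (λ { (V , _ , refl) → 𝟙-nonNeg V }) p) eq
... | T′ , z≡ , dis , refl with Span⇒⋃ p z≡
... | Ts , es , ds , refl = U ∷ Ts , U∈E ∷ es , All.tabulate dis′ ∷ ds , refl
  where
  dis′ : ∀ {V} → V List.∈ Ts → Disjoint U V
  dis′ {V} V∈Ts (x , x∈) with Subset.x∈p∩q⁻ U V x∈
  ... | x∈U , x∈V = dis (x , Subset.x∈p∩q⁺ (x∈U , ⊆⋃ V∈Ts x∈V))

-- Finite search

length≤∣⋃∣ : ∀ {n} {Ts : List (Subset n)} → All Nonempty Ts → AllPairs Disjoint Ts → List.length Ts ℕ.≤ ∣ ⋃ Ts ∣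
length≤∣⋃∣ []       []       = ℕ.z≤n
length≤∣⋃∣ {Ts = T ∷ Ts} ((x , x∈T) ∷ ne) (d ∷ ds) = ℕ.≤-<-trans (length≤∣⋃∣ ne ds)
  (Subset.p⊂q⇒∣p∣<∣q∣ (Subset.q⊆p∪q T (⋃ Ts) , x , Subset.p⊆p∪q (⋃ Ts) x∈T ,
    λ x∈⋃ → disjoint-⋃ d (x , Subset.x∈p∩q⁺ (x∈T , x∈⋃))))

-- Search among the lists of at most k subsets.
anyBounded? : ∀ {n} k {P : Pred (List (Subset n)) 0ℓ} → Decidable P →
              Dec (∃[ Ts ] List.length Ts ℕ.≤ k × P Ts)
anyBounded? zero P? = map′ (λ p → [] , ℕ.z≤n , p) (λ { ([] , _ , p) → p }) (P? [])
anyBounded? (suc k) P? = map′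
  (λ { (inj₁ p) → [] , ℕ.z≤n , p ; (inj₂ (T , Ts , l , p)) → T ∷ Ts , ℕ.s≤s l , p })
  (λ { ([] , _ , p) → inj₁ p ; (T ∷ Ts , ℕ.s≤s l , p) → inj₂ (T , Ts , l , p) })
  (P? [] ⊎-dec Subset.anySubset? (λ T → anyBounded? k (λ Ts → P? (T ∷ Ts))))

-- All subsets of Fin n.
subsets : ∀ n → List (Subset n)
subsets zero    = [] ∷ []
subsets (suc n) = List.map (inside ∷_) (subsets n) List.++ List.map (outside ∷_) (subsets n)

∈-subsets : ∀ {n} (S : Subset n) → S List.∈ subsets n
∈-subsets []            = here refl
∈-subsets (inside  ∷ S) = List.∈-++⁺ˡ (List.∈-map⁺ (inside ∷_) (∈-subsets S))
∈-subsets (outside ∷ S) = List.∈-++⁺ʳ _ (List.∈-map⁺ (outside ∷_) (∈-subsets S))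

-- Real numbers given by natural numbers

fromℕ-≤ : ∀ {a b} → a ℕ.≤ b → fromℕ a ≤ fromℕ b
fromℕ-≤ {a} {b} a≤b k = ℚ.≤-trans (p≤q⇒p-q≤0 (ι-≤ {+ a} {+ b} (ℤ.+≤+ a≤b))) (ℚ.+-mono-≤ (2⁻-nonNeg k) (2⁻-nonNeg k))

fromℕ-< : ∀ {a b} → a ℕ.< b → fromℕ a < fromℕ b
fromℕ-< {a} {b} a<b = 2 , ℚ.<-≤-trans (ℚ.*<* (ℤ.+<+ (ℕ.s≤s (ℕ.s≤s ℕ.z≤n)))) (begin
  1ℚ                  ≡⟨ solve 1 (λ a → con 1ℚ := (con 1ℚ :+ a) :- a) refl (ι (+ a)) ⟩
  1ℚ ℚ.+ ι (+ a) ℚ.- ι (+ a) ≡⟨ cong (ℚ._- ι (+ a)) (ι-+ 1ℤ (+ a)) ⟨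
  ι (+ suc a) ℚ.- ι (+ a) ≤⟨ ℚ.+-monoˡ-≤ (ℚ.- ι (+ a)) (ι-≤ {+ suc a} {+ b} (ℤ.+≤+ a<b)) ⟩
  ι (+ b) ℚ.- ι (+ a) ∎)
  where
  open ℚ.≤-Reasoning
  open ℚSolver.+-*-Solver

fromℕ-cancel-< : ∀ {a b} → fromℕ a < fromℕ b → a ℕ.< b
fromℕ-cancel-< {a} {b} (k , lt) = ℕ.≰⇒> λ b≤a → ℚ.<-irrefl refl (ℚ.<-≤-trans
  (ℚ.≤-<-trans (ℚ.+-mono-≤ (2⁻-nonNeg k) (2⁻-nonNeg k)) lt)
  (p≤q⇒p-q≤0 (ι-≤ {+ b} {+ a} (ℤ.+≤+ b≤a))))

≡⇒≤ : ∀ {x y} → (∀ k → seq x k ≡ seq y k) → x ≤ y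
≡⇒≤ eq k = ℚ.≤-trans (p≤q⇒p-q≤0 (ℚ.≤-reflexive (eq k))) (ℚ.+-mono-≤ (2⁻-nonNeg k) (2⁻-nonNeg k))

≡⇒≃ : ∀ {x y} → (∀ k → seq x k ≡ seq y k) → x ≃ y
≡⇒≃ {x} {y} eq = ≡⇒≤ {x} {y} eq , ≡⇒≤ {y} {x} (sym ∘ eq)

-- Distinct natural numbers differ by at least one.
fromℕ-gap : ∀ {a b} → a ℕ.< b → fromℕ a + 1ℝ ≤ fromℕ b
fromℕ-gap {a} {b} a<b k = ℚ.≤-trans
  (p≤q⇒p-q≤0 (subst (ℚ._≤ ι (+ b)) (trans (ι-+ 1ℤ (+ a)) (ℚ.+-comm 1ℚ (ι (+ a))))
    (ι-≤ {+ suc a} {+ b} (ℤ.+≤+ a<b))))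
  (ℚ.+-mono-≤ (2⁻-nonNeg k) (2⁻-nonNeg k))

-- Endpoints of the canonical representation

∈⟦⟧⁺ : ∀ {n x} {A : Pred (Fin n) 0ℓ} (A? : Decidable A) → A x → x ∈ ⟦ A? ⟧
∈⟦⟧⁺ {x = x} A? a = Vec.lookup⇒[]= x _ (trans (Vec.lookup∘tabulate (does ∘ A?) x) (dec-true (A? x) a))

∈⟦⟧⁻ : ∀ {n x} {A : Pred (Fin n) 0ℓ} (A? : Decidable A) → x ∈ ⟦ A? ⟧ → A x
∈⟦⟧⁻ {x = x} A? x∈ with A? x in eq
... | yes a = a
... | no  _ with () ← trans (sym (Vec.[]=⇒lookup x∈)) (trans (Vec.lookup∘tabulate (does ∘ A?) x) (cong does eq))

lookup-injective : ∀ {A : Set} {xs : List A} → Unique xs → ∀ i j → List.lookup xs i ≡ List.lookup xs j → i ≡ j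
lookup-injective (_   ∷ _)  zero    zero    _  = refl
lookup-injective (x∉ ∷ _)  zero    (suc j) eq = contradiction eq (All.lookup x∉ (List.∈-lookup j))
lookup-injective (x∉ ∷ _)  (suc i) zero    eq = contradiction (sym eq) (All.lookup x∉ (List.∈-lookup i))
lookup-injective (_   ∷ !) (suc i) (suc j) eq = cong suc (lookup-injective ! i j eq)

injective⇒surjective : ∀ {m} (g : Fin m → Fin m) → (∀ {j k} → g j ≡ g k → j ≡ k) → ∀ i → ∃[ k ] g k ≡ i
injective⇒surjective {m} g inj i with Fin.any? (λ k → g k Fin.≟ i)
... | yes p = p
... | no ¬p with Fin.pigeonhole (ℕ.n<1+n m) (λ { zero → i ; (suc k) → g k })
...   | zero  , suc k , _ , eq   = contradiction (k , sym eq) ¬p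
...   | suc j , suc k , j<k , eq = contradiction (cong suc (inj eq)) (Fin.<⇒≢ j<k)

-- If the entries of a list without repetitions are determined by labels that are
-- smaller than its length, then all these labels occur and each entry determines
-- its label.
labels-exhaust : ∀ {n} {A : Set} (Ds : List A) → Unique Ds → (D : Fin n → A) →
  (∀ {d} → d List.∈ Ds → ∃[ z ] d ≡ D z) → (ℓ : Fin n → ℕ) → (∀ z → ℓ z ℕ.< List.length Ds) →
  (∀ {y z} → ℓ y ≡ ℓ z → D y ≡ D z) →
  (∀ {i} → i ℕ.< List.length Ds → ∃[ z ] ℓ z ≡ i) × (∀ {y z} → D y ≡ D z → ℓ y ≡ ℓ z)
labels-exhaust {n} Ds !Ds D ∈Ds⇒D ℓ ℓ<len ℓ⇒D = (λ i<len → let k , eq = attained i<len in rep k , eq) , determined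
  where
  rep : Fin (List.length Ds) → Fin n
  rep k = proj₁ (∈Ds⇒D (List.∈-lookup k))

  rep-injective : ∀ {j k} → D (rep j) ≡ D (rep k) → j ≡ k
  rep-injective {j} {k} eq = lookup-injective !Ds j k
    (trans (proj₂ (∈Ds⇒D (List.∈-lookup j))) (trans eq (sym (proj₂ (∈Ds⇒D (List.∈-lookup k))))))

  attained : ∀ {i} → i ℕ.< List.length Ds → ∃[ k ] ℓ (rep k) ≡ i
  attained i<len with injective⇒surjective (λ k → Fin.fromℕ< (ℓ<len (rep k)))
      (λ {j} {k} eq → rep-injective (ℓ⇒D (Fin.fromℕ<-injective _ _ (ℓ<len (rep j)) (ℓ<len (rep k)) eq)))
      (Fin.fromℕ< i<len)
  ... | k , eq = k , Fin.fromℕ<-injective _ _ (ℓ<len (rep k)) i<len eq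

  determined : ∀ {y z} → D y ≡ D z → ℓ y ≡ ℓ z
  determined {y} {z} eq with attained (ℓ<len y) | attained (ℓ<len z)
  ... | j , ℓj | k , ℓk = trans (sym ℓj) (trans (cong (ℓ ∘ rep) (rep-injective
    (trans (ℓ⇒D ℓj) (trans eq (sym (ℓ⇒D ℓk)))))) ℓk)

-- Every i < m is a right endpoint if every i < m is a left endpoint and distinct
-- left endpoints are separated by right endpoints. For i + 1 < m the right
-- endpoint i separates the left endpoints i and i + 1; for i + 1 = m it belongs
-- to any interval with left endpoint i.
rightEnds-exhaust : ∀ {n m} (ℓ r : Fin n → ℕ) → (∀ x → ℓ x ℕ.≤ r x) → (∀ x → r x ℕ.< m) →
  (∀ {i} → i ℕ.< m → ∃[ z ] ℓ z ≡ i) →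
  (∀ {y z} → (∀ x → (r x ℕ.< ℓ y → r x ℕ.< ℓ z) × (r x ℕ.< ℓ z → r x ℕ.< ℓ y)) → ℓ y ≡ ℓ z) →
  ∀ {i} → i ℕ.< m → ∃[ x ] r x ≡ i
rightEnds-exhaust {m = m} ℓ r ℓ≤r r<m leftLevel separate {i} i<m with Fin.any? (λ x → r x ℕ.≟ i)
... | yes p = p
... | no ¬p with suc i ℕ.<? m
...   | no  i≮ = let x , ℓ≡ = leftLevel i<m in
  contradiction (x , ℕ.≤-antisym (ℕ.≤-pred (ℕ.≤-trans (r<m x) (ℕ.≮⇒≥ i≮))) (subst (ℕ._≤ r x) ℓ≡ (ℓ≤r x))) ¬p
...   | yes i< with leftLevel i<m | leftLevel i<
...     | y , ℓy | z , ℓz = contradiction (trans (sym ℓy) (trans ℓy≡ℓz ℓz)) (ℕ.1+n≢n ∘ sym)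
  where
  ℓy≡ℓz : ℓ y ≡ ℓ z
  ℓy≡ℓz = separate λ x →
    (λ lt → subst (r x ℕ.<_) (sym ℓz) (ℕ.m<n⇒m<1+n (subst (r x ℕ.<_) ℓy lt))) ,
    (λ lt → subst (r x ℕ.<_) (sym ℓy) (ℕ.≤∧≢⇒< (ℕ.≤-pred (subst (r x ℕ.<_) ℓz lt)) λ eq → ¬p (x , eq)))

-- An element outside β with r minimal, unless β contains everything.
minimalOutside : ∀ {n m} (r : Fin n → ℕ) → (∀ x → r x ℕ.< m) → (β : Subset n) →
                 (∀ x → x ∈ β) ⊎ ∃[ x ] x ∉ β × (∀ y → r y ℕ.< r x → y ∈ β)
minimalOutside {n} {m} r r<m β = Sum.map₁ (λ all x → all x (r<m x)) (search m)
  where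
  search : ∀ k → (∀ x → r x ℕ.< k → x ∈ β) ⊎ ∃[ x ] x ∉ β × (∀ y → r y ℕ.< r x → y ∈ β)
  search zero = inj₁ λ _ ()
  search (suc k) with search k
  ... | inj₂ found = inj₂ found
  ... | inj₁ below with Fin.any? (λ x → r x ℕ.≟ k ×-dec ¬? (x Subset.∈? β))
  ...   | yes (x , refl , x∉) = inj₂ (x , x∉ , below)
  ...   | no  none = inj₁ λ x r<1+k → Sum.[ below x ,
    (λ r≡k → decidable-stable (x Subset.∈? β) λ x∉ → none (x , r≡k , x∉)) ]′
    (ℕ.m≤n⇒m<n∨m≡n (ℕ.≤-pred r<1+k))

module Geometry {n : ℕ} {P : IntervalOrder n} (C : CanonicalRepresentation P) where
  open IntervalOrder P using (_≺_; _≺?_; isDecStrictPartialOrder)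
  open CanonicalRepresentation C

  m : ℕ
  m = magnitude P

  ≺⇒< : ∀ {x y} → x ≺ y → r x ℕ.< ℓ y
  ≺⇒< {x} {y} = fromℕ-cancel-< ∘ Equivalence.to (IsRepresentation.order isRepresentation x y)

  <⇒≺ : ∀ {x y} → r x ℕ.< ℓ y → x ≺ y
  <⇒≺ {x} {y} = Equivalence.from (IsRepresentation.order isRepresentation x y) ∘ fromℕ-<

  ≤⇒⊀ : ∀ {x y} → ℓ y ℕ.≤ r x → ¬ x ≺ y
  ≤⇒⊀ ℓ≤r x≺y = ℕ.<⇒≱ (≺⇒< x≺y) ℓ≤r

  ⊀⇒≤ : ∀ {x y} → ¬ x ≺ y → ℓ y ℕ.≤ r x
  ⊀⇒≤ ¬≺ = ℕ.≮⇒≥ (¬≺ ∘ <⇒≺)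

  ℓ≤r : ∀ x → ℓ x ℕ.≤ r x
  ℓ≤r x = ⊀⇒≤ (IsDecStrictPartialOrder.irrefl isDecStrictPartialOrder refl)

  ℓ<m : ∀ x → ℓ x ℕ.< m
  ℓ<m x = Equivalence.to (endpoints (ℓ x)) (x , inj₁ refl)

  r<m : ∀ x → r x ℕ.< m
  r<m x = Equivalence.to (endpoints (r x)) (x , inj₂ refl)

  private
    Ds : List (Subset n)
    Ds = List.deduplicate (Vec.≡-dec Bool._≟_) (List.map (downSet P) (List.allFin n))

    downSet-cong : ∀ {y z} → (∀ x → r x ℕ.< ℓ y ⇔ r x ℕ.< ℓ z) → downSet P y ≡ downSet P z
    downSet-cong {y} {z} eq = Vec.tabulate-cong λ x → does-⇔
      (mk⇔ (<⇒≺ ∘ Equivalence.to (eq x) ∘ ≺⇒<) (<⇒≺ ∘ Equivalence.from (eq x) ∘ ≺⇒<)) (x ≺? y) (x ≺? z)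

    ∈Ds⇒downSet : ∀ {D} → D List.∈ Ds → ∃[ z ] D ≡ downSet P z
    ∈Ds⇒downSet D∈ = let z , _ , eq = List.∈-map⁻ (downSet P) (List.∈-deduplicate⁻ (Vec.≡-dec Bool._≟_) _ D∈) in z , eq

    -- The down-set D(z) depends only on ℓ z, which is less than the number m of
    -- distinct down-sets. Hence every i < m is a left endpoint, and different left
    -- endpoints have different down-sets.
    levels : (∀ {i} → i ℕ.< m → ∃[ z ] ℓ z ≡ i) × (∀ {y z} → downSet P y ≡ downSet P z → ℓ y ≡ ℓ z)
    levels = labels-exhaust Ds (deduplicate-! (Vec.≡-dec Bool._≟_) _) (downSet P) ∈Ds⇒downSet ℓ ℓ<m
      (λ ℓ≡ → downSet-cong λ x → mk⇔ (subst (r x ℕ.<_) ℓ≡) (subst (r x ℕ.<_) (sym ℓ≡)))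

  -- Each of 0, ..., m - 1 is a left endpoint and a right endpoint.
  leftLevel : ∀ {i} → i ℕ.< m → ∃[ x ] ℓ x ≡ i
  leftLevel = proj₁ levels

  rightLevel : ∀ {i} → i ℕ.< m → ∃[ x ] r x ≡ i
  rightLevel = rightEnds-exhaust ℓ r ℓ≤r r<m leftLevel λ same → proj₂ levels
    (downSet-cong λ x → mk⇔ (proj₁ (same x)) (proj₂ (same x)))

  private
    gap? : ∀ i → Decidable (λ x → (1 ℕ.≤ i × i ℕ.< m) × (ℓ x ℕ.≤ i ℕ.∸ 1 × i ℕ.≤ r x))
    gap? i x = ((1 ℕ.≤? i) ×-dec (i ℕ.<? m)) ×-dec ((ℓ x ℕ.≤? i ℕ.∸ 1) ×-dec (i ℕ.≤? r x))

  ∈gapSet⁺ : ∀ {i x} → ℓ x ℕ.< i → i ℕ.≤ r x → x ∈ gapSet C i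
  ∈gapSet⁺ {suc i} {x} ℓ<i i≤r =
    ∈⟦⟧⁺ (gap? (suc i)) ((ℕ.s≤s ℕ.z≤n , ℕ.≤-<-trans i≤r (r<m x)) , ℕ.≤-pred ℓ<i , i≤r)

  ∈gapSet⁻ : ∀ {i x} → x ∈ gapSet C i → ℓ x ℕ.< i × i ℕ.≤ r x
  ∈gapSet⁻ {i} x∈ with ∈⟦⟧⁻ (gap? i) x∈
  ∈gapSet⁻ {suc i} _ | _ , ℓ≤ , i≤r = ℕ.s≤s ℓ≤ , i≤r
  ∈gapSet⁻ {zero} _ | (() , _) , _

  ∈leftBorderline⁺ : ∀ {i x} → suc (r x) ≡ i → x ∈ leftBorderline C i
  ∈leftBorderline⁺ {i} = ∈⟦⟧⁺ (λ x → suc (r x) ℕ.≟ i)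

  ∈leftBorderline⁻ : ∀ {i x} → x ∈ leftBorderline C i → suc (r x) ≡ i
  ∈leftBorderline⁻ {i} = ∈⟦⟧⁻ (λ x → suc (r x) ℕ.≟ i)

  ∈rightBorderline⁺ : ∀ {i x} → ℓ x ≡ i → x ∈ rightBorderline C i
  ∈rightBorderline⁺ {i} = ∈⟦⟧⁺ (λ x → ℓ x ℕ.≟ i)

  ∈rightBorderline⁻ : ∀ {i x} → x ∈ rightBorderline C i → ℓ x ≡ i
  ∈rightBorderline⁻ {i} = ∈⟦⟧⁻ (λ x → ℓ x ℕ.≟ i)

  -- A cut separates all endpoints, in an order compatible with every interval
  -- representation, into an initial and a final part: α consists of the elements
  -- whose left endpoint is in the initial part, β of those whose right endpoint
  -- is. So the elements of α outside β are the intervals that the cut meets.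
  record IsCut (α β : Subset n) : Set where
    field
      ⊀-cut : ∀ {x y} → ¬ x ≺ y → x ∈ β → y ∈ α
      ≺-cut : ∀ {x y} → x ≺ y → y ∈ α → x ∈ β

  -- Let i be the least right endpoint of an element outside β. Then α contains
  -- everything with ℓ < i and nothing with ℓ > i, since each level has both kinds of endpoints. If
  -- α misses some left endpoint at level i, then β consists of the elements with
  -- r < i, and the cut meets G_i and a part of R_i. Otherwise it meets G_(i+1) and
  -- a part of L_(i+1).
  cut⇒extender : ∀ {α β} → IsCut α β → Nonempty (α ∩ ∁ β) → IsFundamentalExtender C (α ∩ ∁ β)
  cut⇒extender {α} {β} cut ne@(x₁ , x₁∈) = cases (minimalOutside r r<m β)
    where
    open IsCut cut

    module _ {x₀} (x₀∉ : x₀ ∉ β) (below : ∀ y → r y ℕ.< r x₀ → y ∈ β) where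
      i : ℕ
      i = r x₀

      ℓ<i⇒∈α : ∀ {y} → ℓ y ℕ.< i → y ∈ α
      ℓ<i⇒∈α {y} ℓ<i = let w , rw≡ = rightLevel (ℓ<m y) in
        ⊀-cut (≤⇒⊀ (ℕ.≤-reflexive (sym rw≡))) (below w (subst (ℕ._< i) (sym rw≡) ℓ<i))

      ∈α⇒ℓ≤i : ∀ {y} → y ∈ α → ℓ y ℕ.≤ i
      ∈α⇒ℓ≤i y∈ = ℕ.≮⇒≥ λ lt → x₀∉ (≺-cut (<⇒≺ lt) y∈)

      ∉β⇒i≤r : ∀ {x} → x ∉ β → i ℕ.≤ r x
      ∉β⇒i≤r x∉ = ℕ.≮⇒≥ (x∉ ∘ below _)

      right : ∀ {y₀} → ℓ y₀ ≡ i → y₀ ∉ α → α ∩ ∁ β ≡ gapSet C i ∪ (rightBorderline C i ∩ α)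
      right ℓy₀≡ y₀∉ = Subset.⊆-antisym to from
        where
        i≤r⇒∉β : ∀ {x} → i ℕ.≤ r x → x ∉ β
        i≤r⇒∉β i≤r x∈ = y₀∉ (⊀-cut (≤⇒⊀ (subst (ℕ._≤ _) (sym ℓy₀≡) i≤r)) x∈)
        to : α ∩ ∁ β ⊆ gapSet C i ∪ (rightBorderline C i ∩ α)
        to {x} x∈ = let x∈α , x∈∁ = Subset.x∈p∩q⁻ α (∁ β) x∈ in Subset.x∈p∪q⁺ (Sum.map
          (λ ℓ<i → ∈gapSet⁺ ℓ<i (∉β⇒i≤r (Subset.x∈∁p⇒x∉p x∈∁)))
          (λ ℓ≡i → Subset.x∈p∩q⁺ (∈rightBorderline⁺ ℓ≡i , x∈α))
          (ℕ.m≤n⇒m<n∨m≡n (∈α⇒ℓ≤i x∈α)))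
        from : gapSet C i ∪ (rightBorderline C i ∩ α) ⊆ α ∩ ∁ β
        from x∈ = Sum.[
          (λ x∈G → let ℓ<i , i≤r = ∈gapSet⁻ x∈G in
            Subset.x∈p∩q⁺ (ℓ<i⇒∈α ℓ<i , Subset.x∉p⇒x∈∁p (i≤r⇒∉β i≤r))) ,
          (λ x∈Z → let x∈R , x∈α = Subset.x∈p∩q⁻ (rightBorderline C i) α x∈Z in
            Subset.x∈p∩q⁺ (x∈α , Subset.x∉p⇒x∈∁p (i≤r⇒∉β
              (ℕ.≤-trans (ℕ.≤-reflexive (sym (∈rightBorderline⁻ x∈R))) (ℓ≤r _)))))
          ]′ (Subset.x∈p∪q⁻ (gapSet C i) _ x∈)

      left : (∀ y → ℓ y ≡ i → y ∈ α) → α ∩ ∁ β ≡ gapSet C (suc i) ∪ (leftBorderline C (suc i) ∩ ∁ β)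
      left all = Subset.⊆-antisym to from
        where
        ℓ≤i⇒∈α : ∀ {y} → ℓ y ℕ.≤ i → y ∈ α
        ℓ≤i⇒∈α {y} = Sum.[ ℓ<i⇒∈α , all y ]′ ∘ ℕ.m≤n⇒m<n∨m≡n
        i<r⇒∉β : ∀ {x} → i ℕ.< r x → x ∉ β
        i<r⇒∉β {x} i<r x∈ = let y , ℓy≡ = leftLevel (r<m x) in
          ℕ.<⇒≱ i<r (subst (ℕ._≤ i) ℓy≡ (∈α⇒ℓ≤i (⊀-cut (≤⇒⊀ (ℕ.≤-reflexive ℓy≡)) x∈)))
        to : α ∩ ∁ β ⊆ gapSet C (suc i) ∪ (leftBorderline C (suc i) ∩ ∁ β)
        to {x} x∈ = let x∈α , x∈∁ = Subset.x∈p∩q⁻ α (∁ β) x∈ in Subset.x∈p∪q⁺ (Sum.map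
          (λ i<r → ∈gapSet⁺ (ℕ.s≤s (∈α⇒ℓ≤i x∈α)) i<r)
          (λ i≡r → Subset.x∈p∩q⁺ (∈leftBorderline⁺ (cong suc (sym i≡r)) , x∈∁))
          (ℕ.m≤n⇒m<n∨m≡n (∉β⇒i≤r (Subset.x∈∁p⇒x∉p x∈∁))))
        from : gapSet C (suc i) ∪ (leftBorderline C (suc i) ∩ ∁ β) ⊆ α ∩ ∁ β
        from x∈ = Sum.[
          (λ x∈G → let ℓ<i , i≤r = ∈gapSet⁻ x∈G in
            Subset.x∈p∩q⁺ (ℓ≤i⇒∈α (ℕ.≤-pred ℓ<i) , Subset.x∉p⇒x∈∁p (i<r⇒∉β i≤r))) ,
          (λ x∈Z → let x∈L , x∈∁ = Subset.x∈p∩q⁻ (leftBorderline C (suc i)) (∁ β) x∈Z in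
            Subset.x∈p∩q⁺ (ℓ≤i⇒∈α 
              (ℕ.≤-trans (ℓ≤r _) (ℕ.≤-reflexive (ℕ.suc-injective (∈leftBorderline⁻ x∈L)))) , x∈∁))
          ]′ (Subset.x∈p∪q⁻ (gapSet C (suc i)) _ x∈)

      extender : Dec (∃[ y ] ℓ y ≡ i × y ∉ α) → IsFundamentalExtender C (α ∩ ∁ β)
      extender (yes (y₀ , ℓy₀≡ , y₀∉)) = ne , i , rightBorderline C i ∩ α , ℕ.<⇒≤ (r<m x₀) ,
        inj₂ (Subset.p∩q⊆p _ α) , right ℓy₀≡ y₀∉
      extender (no none) = ne , suc i , leftBorderline C (suc i) ∩ ∁ β , r<m x₀ ,
        inj₁ (Subset.p∩q⊆p _ (∁ β)) ,
        left λ y ℓ≡i → decidable-stable (y Subset.∈? α) λ y∉ → none (y , ℓ≡i , y∉)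

    cases : (∀ x → x ∈ β) ⊎ (∃[ x ] x ∉ β × (∀ y → r y ℕ.< r x → y ∈ β)) →
            IsFundamentalExtender C (α ∩ ∁ β)
    cases (inj₁ all) = contradiction (all x₁) (Subset.x∈∁p⇒x∉p (proj₂ (Subset.x∈p∩q⁻ α (∁ β) x₁∈)))
    cases (inj₂ (x₀ , x₀∉ , below)) = extender x₀∉ below
      (Fin.any? (λ y → (ℓ y ℕ.≟ r x₀) ×-dec ¬? (y Subset.∈? α)))

-- Integral points of the cone as shifts of the canonical endpoints

upperBound : ∀ {n} (f : Fin n → ℕ) → ∃[ T ] ∀ x → f x ℕ.≤ T
upperBound {zero}  f = 0 , λ ()
upperBound {suc n} f with upperBound (f ∘ suc)
... | T , ≤T = f zero ℕ.⊔ T , λ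
  { zero → ℕ.m≤m⊔n _ _ ; (suc x) → ℕ.≤-trans (≤T x) (ℕ.m≤n⊔m (f zero) T) }

module ConePoints {n : ℕ} {P : IntervalOrder n} (C : CanonicalRepresentation P) where
  open IntervalOrder P using (_≺_; _≺?_; isDecStrictPartialOrder)
  open CanonicalRepresentation C
  open Geometry C

  irreflexive : ∀ x → ¬ x ≺ x
  irreflexive x = IsDecStrictPartialOrder.irrefl isDecStrictPartialOrder refl

  -- The endpoints of the canonical representation can be moved right by d (left
  -- endpoints) and e (right endpoints). Since each level carries both kinds of
  -- endpoints, the moved endpoints form a representation exactly if a left endpoint
  -- is moved at most as far as a right endpoint that does not precede it, and at
  -- least as far as a right endpoint that precedes it. The vectors e - d are the
  -- integral points of the cone.
  record IsShift (d e : Fin n → ℕ) : Set where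
    field
      ⊀-shift : ∀ {x y} → ¬ x ≺ y → d y ℕ.≤ e x
      ≺-shift : ∀ {x y} → x ≺ y → e x ℕ.≤ d y

  shift⇒cone : ∀ {d e} → IsShift d e → ∀ z → (∀ x → lookup z x ℤ.+ + d x ≡ + e x) →
               IntegralPoint (LengthCone C) z
  shift⇒cone {d} {e} shift z eq = lengths (fromℕ ∘ ℓ′) (fromℕ ∘ r′) ,
    (fromℕ ∘ ℓ′ , fromℕ ∘ r′ , isRep ,
      λ x → ≡⇒≃ {lengths (fromℕ ∘ ℓ′) (fromℕ ∘ r′) x} {lengths (fromℕ ∘ ℓ′) (fromℕ ∘ r′) x} λ _ → refl) ,
    λ x → ≡⇒≃ {fromℤ (lookup z x)} {lengths (fromℕ ∘ ℓ′) (fromℕ ∘ r′) x - canonicalLengths C x} λ _ → value x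
    where
    open IsShift shift
    ℓ′ r′ : Fin n → ℕ
    ℓ′ x = ℓ x ℕ.+ d x
    r′ x = r x ℕ.+ e x

    ≺⇒<′ : ∀ {x y} → x ≺ y → r′ x ℕ.< ℓ′ y
    ≺⇒<′ x≺y = ℕ.+-mono-<-≤ (≺⇒< x≺y) (≺-shift x≺y)

    ⊀⇒≤′ : ∀ {x y} → ¬ x ≺ y → ℓ′ y ℕ.≤ r′ x
    ⊀⇒≤′ x⊀y = ℕ.+-mono-≤ (⊀⇒≤ x⊀y) (⊀-shift x⊀y)

    isRep : IsRepresentation P (fromℕ ∘ ℓ′) (fromℕ ∘ r′)
    isRep = record
      { nonempty = λ x → fromℕ-≤ (⊀⇒≤′ (irreflexive x))
      ; order    = λ x y → mk⇔ (fromℕ-< ∘ ≺⇒<′) (λ lt → decidable-stable (x ≺? y) λ x⊀y →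
                     ℕ.<⇒≱ (fromℕ-cancel-< lt) (⊀⇒≤′ x⊀y))
      ; gap      = λ x y → fromℕ-gap ∘ ≺⇒<′
      }

    value : ∀ x → ι (lookup z x) ≡
                  (ι (+ r′ x) ℚ.- ι (+ ℓ′ x)) ℚ.- (ι (+ r x) ℚ.- ι (+ ℓ x))
    value x = sym (begin
      (ι (+ r′ x) ℚ.- ι (+ ℓ′ x)) ℚ.- (ι (+ r x) ℚ.- ι (+ ℓ x))
        ≡⟨ cong₂ (λ p q → (p ℚ.- q) ℚ.- (ι (+ r x) ℚ.- ι (+ ℓ x)))
             (trans (ι-+ (+ r x) (+ e x)) (cong (ι (+ r x) ℚ.+_)
               (trans (cong ι (sym (eq x))) (ι-+ (lookup z x) (+ d x)))))
             (ι-+ (+ ℓ x) (+ d x)) ⟩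
      ((ι (+ r x) ℚ.+ (ι (lookup z x) ℚ.+ ι (+ d x))) ℚ.- (ι (+ ℓ x) ℚ.+ ι (+ d x))) ℚ.- (ι (+ r x) ℚ.- ι (+ ℓ x))
        ≡⟨ solve 4 (λ r z d l → ((r :+ (z :+ d)) :- (l :+ d)) :- (r :- l) := z) refl
             (ι (+ r x)) (ι (lookup z x)) (ι (+ d x)) (ι (+ ℓ x)) ⟩
      ι (lookup z x) ∎)
      where
      open ≡-Reasoning
      open ℚSolver.+-*-Solver

  -- Move everything after the cut right by one.
  cut⇒cone : ∀ {α β} → IsCut α β → IntegralPoint (LengthCone C) (𝟙 (α ∩ ∁ β))
  cut⇒cone {α} {β} cut = shift⇒cone {d} {e} shift (𝟙 (α ∩ ∁ β)) value
    where
    open IsCut cut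
    d e : Fin n → ℕ
    d x = if does (x Subset.∈? α) then 0 else 1
    e x = if does (x Subset.∈? β) then 0 else 1

    shift : IsShift d e
    shift = record { ⊀-shift = ⊀-shift ; ≺-shift = ≺-shift }
      where
      ⊀-shift : ∀ {x y} → ¬ x ≺ y → d y ℕ.≤ e x
      ⊀-shift {x} {y} x⊀y with y Subset.∈? α | x Subset.∈? β
      ... | yes _  | _      = ℕ.z≤n
      ... | no  _  | no  _  = ℕ.s≤s ℕ.z≤n
      ... | no  y∉ | yes x∈ = contradiction (⊀-cut x⊀y x∈) y∉
      ≺-shift : ∀ {x y} → x ≺ y → e x ℕ.≤ d y
      ≺-shift {x} {y} x≺y with x Subset.∈? β | y Subset.∈? α
      ... | yes _  | _      = ℕ.z≤n
      ... | no  _  | no  _  = ℕ.s≤s ℕ.z≤n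
      ... | no  x∉ | yes y∈ = contradiction (≺-cut x≺y y∈) x∉

    value : ∀ x → lookup (𝟙 (α ∩ ∁ β)) x ℤ.+ + d x ≡ + e x
    value x with x Subset.∈? α | x Subset.∈? β
    ... | yes x∈α | no  x∉β = cong (ℤ._+ + 0) (lookup-𝟙-∈ (Subset.x∈p∩q⁺ (x∈α , Subset.x∉p⇒x∈∁p x∉β)))
    ... | yes _   | yes x∈β = cong (ℤ._+ + 0) (lookup-𝟙-∉ λ x∈ → Subset.x∈∁p⇒x∉p (Subset.p∩q⊆q α (∁ β) x∈) x∈β)
    ... | no  x∉α | no  _   = cong (ℤ._+ + 1) (lookup-𝟙-∉ (x∉α ∘ Subset.p∩q⊆p α (∁ β)))
    ... | no  x∉α | yes x∈β = contradiction (⊀-cut (irreflexive x) x∈β) x∉α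

  -- For a part Z of L_i, the initial part of the cut consists of the left endpoints
  -- ℓ < i and the right endpoints r < i outside Z. For a part Z of R_i, it consists
  -- of the right endpoints r < i, the left endpoints ℓ < i, and those of Z.
  extender⇒cut : ∀ {S} → IsFundamentalExtender C S → ∃₂ λ α β → IsCut α β × α ∩ ∁ β ≡ S
  extender⇒cut (_ , i , Z , _ , inj₁ Z⊆L , refl) =
    α , β , record { ⊀-cut = ⊀-cut ; ≺-cut = ≺-cut } , Subset.⊆-antisym to from
    where
    r? : Decidable (λ x → r x ℕ.< i × x ∉ Z)
    r? x = (r x ℕ.<? i) ×-dec ¬? (x Subset.∈? Z)
    ℓ? : Decidable (λ x → ℓ x ℕ.< i)
    ℓ? x = ℓ x ℕ.<? i
    α β : Subset n
    α = ⟦ ℓ? ⟧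
    β = ⟦ r? ⟧
    ⊀-cut : ∀ {x y} → ¬ x ≺ y → x ∈ β → y ∈ α
    ⊀-cut x⊀y x∈β = ∈⟦⟧⁺ ℓ? (ℕ.≤-<-trans (⊀⇒≤ x⊀y) (proj₁ (∈⟦⟧⁻ r? x∈β)))
    ≺-cut : ∀ {x y} → x ≺ y → y ∈ α → x ∈ β
    ≺-cut x≺y y∈α = let r<ℓ = ≺⇒< x≺y ; ℓ<i = ∈⟦⟧⁻ ℓ? y∈α in
      ∈⟦⟧⁺ r? (ℕ.<-trans r<ℓ ℓ<i , λ x∈Z → ℕ.<⇒≱ ℓ<i (subst (ℕ._≤ _) (∈leftBorderline⁻ (Z⊆L x∈Z)) r<ℓ))
    to : α ∩ ∁ β ⊆ gapSet C i ∪ Z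
    to {x} x∈ with x Subset.∈? Z
    ... | yes x∈Z = Subset.x∈p∪q⁺ (inj₂ x∈Z)
    ... | no  x∉Z = let x∈α , x∈∁ = Subset.x∈p∩q⁻ α (∁ β) x∈ in Subset.x∈p∪q⁺ (inj₁ (∈gapSet⁺ (∈⟦⟧⁻ ℓ? x∈α)
      (ℕ.≮⇒≥ λ r<i → Subset.x∈∁p⇒x∉p x∈∁ (∈⟦⟧⁺ r? (r<i , x∉Z)))))
    from : gapSet C i ∪ Z ⊆ α ∩ ∁ β
    from {x} x∈ = Sum.[
      (λ x∈G → let ℓ<i , i≤r = ∈gapSet⁻ x∈G in Subset.x∈p∩q⁺ (∈⟦⟧⁺ ℓ? ℓ<i ,
        Subset.x∉p⇒x∈∁p λ x∈β → ℕ.<⇒≱ (proj₁ (∈⟦⟧⁻ r? x∈β)) i≤r)) ,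
      (λ x∈Z → Subset.x∈p∩q⁺ (
        ∈⟦⟧⁺ ℓ? (ℕ.≤-<-trans (ℓ≤r x) (ℕ.≤-reflexive (∈leftBorderline⁻ (Z⊆L x∈Z)))) ,
        Subset.x∉p⇒x∈∁p λ x∈β → proj₂ (∈⟦⟧⁻ r? x∈β) x∈Z))
      ]′ (Subset.x∈p∪q⁻ (gapSet C i) Z x∈)
  extender⇒cut (_ , i , Z , _ , inj₂ Z⊆R , refl) =
    α , β , record { ⊀-cut = ⊀-cut ; ≺-cut = ≺-cut } , Subset.⊆-antisym to from
    where
    r? : Decidable (λ x → r x ℕ.< i)
    r? x = r x ℕ.<? i
    ℓ? : Decidable (λ x → ℓ x ℕ.< i ⊎ x ∈ Z)
    ℓ? x = (ℓ x ℕ.<? i) ⊎-dec (x Subset.∈? Z)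
    α β : Subset n
    α = ⟦ ℓ? ⟧
    β = ⟦ r? ⟧
    ⊀-cut : ∀ {x y} → ¬ x ≺ y → x ∈ β → y ∈ α
    ⊀-cut x⊀y x∈β = ∈⟦⟧⁺ ℓ? (inj₁ (ℕ.≤-<-trans (⊀⇒≤ x⊀y) (∈⟦⟧⁻ r? x∈β)))
    ≺-cut : ∀ {x y} → x ≺ y → y ∈ α → x ∈ β
    ≺-cut x≺y y∈α = ∈⟦⟧⁺ r? (ℕ.<-≤-trans (≺⇒< x≺y)
      (Sum.[ ℕ.<⇒≤ , ℕ.≤-reflexive ∘ ∈rightBorderline⁻ ∘ Z⊆R ]′ (∈⟦⟧⁻ ℓ? y∈α)))
    to : α ∩ ∁ β ⊆ gapSet C i ∪ Z
    to {x} x∈ = let x∈α , x∈∁ = Subset.x∈p∩q⁻ α (∁ β) x∈ in Subset.x∈p∪q⁺ (Sum.map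
      (λ ℓ<i → ∈gapSet⁺ ℓ<i (ℕ.≮⇒≥ (Subset.x∈∁p⇒x∉p x∈∁ ∘ ∈⟦⟧⁺ r?))) id (∈⟦⟧⁻ ℓ? x∈α))
    from : gapSet C i ∪ Z ⊆ α ∩ ∁ β
    from {x} x∈ = Sum.[
      (λ x∈G → let ℓ<i , i≤r = ∈gapSet⁻ x∈G in Subset.x∈p∩q⁺ (∈⟦⟧⁺ ℓ? (inj₁ ℓ<i) ,
        Subset.x∉p⇒x∈∁p λ x∈β → ℕ.<⇒≱ (∈⟦⟧⁻ r? x∈β) i≤r)) ,
      (λ x∈Z → Subset.x∈p∩q⁺ (∈⟦⟧⁺ ℓ? (inj₂ x∈Z) ,
        Subset.x∉p⇒x∈∁p λ x∈β → ℕ.<⇒≱ (∈⟦⟧⁻ r? x∈β)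
          (ℕ.≤-trans (ℕ.≤-reflexive (sym (∈rightBorderline⁻ (Z⊆R x∈Z)))) (ℓ≤r x))))
      ]′ (Subset.x∈p∪q⁻ (gapSet C i) Z x∈)

  extender⇒cone : ∀ {S} → IsFundamentalExtender C S → IntegralPoint (LengthCone C) (𝟙 S)
  extender⇒cone ext = let α , β , cut , eq = extender⇒cut ext in
    subst (IntegralPoint (LengthCone C) ∘ 𝟙) eq (cut⇒cone cut)

  -- The characteristic vectors of fundamental extenders.
  ExtenderVector : Pred (Vec ℤ n) 0ℓ
  ExtenderVector h = ∃[ S ] IsFundamentalExtender C S × h ≡ 𝟙 S

  cut⇒Span : ∀ {α β} → IsCut α β → Span ExtenderVector (𝟙 (α ∩ ∁ β))
  cut⇒Span {α} {β} cut = case (Subset.nonempty? (α ∩ ∁ β))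
    where
    case : Dec (Nonempty (α ∩ ∁ β)) → Span ExtenderVector (𝟙 (α ∩ ∁ β))
    case (yes ne) = Span-single (α ∩ ∁ β , cut⇒extender cut ne , refl)
    case (no  em) = subst (Span ExtenderVector) (sym (trans (cong 𝟙 (Subset.Empty-unique em)) 𝟙-⊥)) []

  -- A shift is the sum of its horizontal layers: the T-th layer is the cut that
  -- separates the shifts of size at most T from the others. The sum of the first T
  -- layers is the difference of the shifts truncated at T.
  shift⇒Span : ∀ {d e} → IsShift d e → ∀ z → (∀ x → lookup z x ℤ.+ + d x ≡ + e x) → Span ExtenderVector z
  shift⇒Span {d} {e} shift z eq = subst (Span ExtenderVector) (lookup-ext full) (truncated-Span T)
    where
    open IsShift shift

    truncated : ℕ → Vec ℤ n
    truncated T = Vec.tabulate λ x → + (e x ℕ.⊓ T) ℤ.- + (d x ℕ.⊓ T)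

    lookup-truncated : ∀ T x → lookup (truncated T) x ≡ + (e x ℕ.⊓ T) ℤ.- + (d x ℕ.⊓ T)
    lookup-truncated T = Vec.lookup∘tabulate _

    Td = upperBound d
    Te = upperBound e
    T : ℕ
    T = proj₁ Td ℕ.⊔ proj₁ Te

    full : ∀ x → lookup (truncated T) x ≡ lookup z x
    full x = begin
      lookup (truncated T) x                    ≡⟨ lookup-truncated T x ⟩
      + (e x ℕ.⊓ T) ℤ.- + (d x ℕ.⊓ T)
        ≡⟨ cong₂ (λ a b → + a ℤ.- + b) (ℕ.m≤n⇒m⊓n≡m (ℕ.≤-trans (proj₂ Te x) (ℕ.m≤n⊔m (proj₁ Td) _)))
             (ℕ.m≤n⇒m⊓n≡m (ℕ.≤-trans (proj₂ Td x) (ℕ.m≤m⊔n _ (proj₁ Te)))) ⟩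
      + e x ℤ.- + d x                           ≡⟨ cong (ℤ._- + d x) (eq x) ⟨
      lookup z x ℤ.+ + d x ℤ.- + d x            ≡⟨ solve 2 (λ z d → z :+ d :- d := z) refl (lookup z x) (+ d x) ⟩
      lookup z x                                ∎
      where
      open ≡-Reasoning
      open ℤSolver.+-*-Solver using (solve; con; _:=_; _:+_; _:-_)

    d? : ∀ T → Decidable (λ x → d x ℕ.≤ T)
    d? T x = d x ℕ.≤? T
    e? : ∀ T → Decidable (λ x → e x ℕ.≤ T)
    e? T x = e x ℕ.≤? T

    cut : ∀ T → IsCut ⟦ d? T ⟧ ⟦ e? T ⟧
    cut T = record
      { ⊀-cut = λ x⊀y x∈ → ∈⟦⟧⁺ (d? T) (ℕ.≤-trans (⊀-shift x⊀y) (∈⟦⟧⁻ (e? T) x∈))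
      ; ≺-cut = λ x≺y y∈ → ∈⟦⟧⁺ (e? T) (ℕ.≤-trans (≺-shift x≺y) (∈⟦⟧⁻ (d? T) y∈)) }

    ⊓-step-≤ : ∀ {a T} → a ℕ.≤ T → a ℕ.⊓ suc T ≡ a ℕ.⊓ T
    ⊓-step-≤ a≤T = trans (ℕ.m≤n⇒m⊓n≡m (ℕ.m≤n⇒m≤1+n a≤T)) (sym (ℕ.m≤n⇒m⊓n≡m a≤T))

    ⊓-step-> : ∀ {a T} → a ℕ.≰ T → a ℕ.⊓ suc T ≡ suc (a ℕ.⊓ T)
    ⊓-step-> a≰T = trans (ℕ.m≥n⇒m⊓n≡n (ℕ.≰⇒> a≰T)) (cong suc (sym (ℕ.m≥n⇒m⊓n≡n (ℕ.<⇒≤ (ℕ.≰⇒> a≰T)))))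

    layer : ℕ → Vec ℤ n
    layer T = 𝟙 (⟦ d? T ⟧ ∩ ∁ ⟦ e? T ⟧)

    slice : ∀ T x → lookup (layer T) x ℤ.+ (+ (e x ℕ.⊓ T) ℤ.- + (d x ℕ.⊓ T))
                  ≡ + (e x ℕ.⊓ suc T) ℤ.- + (d x ℕ.⊓ suc T)
    slice T x with d x ℕ.≤? T | e x ℕ.≤? T
    ... | yes d≤ | yes e≤ rewrite ⊓-step-≤ d≤ | ⊓-step-≤ e≤ =
      trans (cong (ℤ._+ _) (lookup-𝟙-∉ λ x∈ → Subset.x∈∁p⇒x∉p (Subset.p∩q⊆q ⟦ d? T ⟧ _ x∈) (∈⟦⟧⁺ (e? T) e≤)))
        (ℤ.+-identityˡ _)
    ... | yes d≤ | no  e≰ rewrite ⊓-step-≤ d≤ | ⊓-step-> e≰ =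
      trans (cong (ℤ._+ _) (lookup-𝟙-∈ (Subset.x∈p∩q⁺ (∈⟦⟧⁺ (d? T) d≤ , Subset.x∉p⇒x∈∁p (e≰ ∘ ∈⟦⟧⁻ (e? T))))))
        (sym (ℤ.+-assoc 1ℤ (+ (e x ℕ.⊓ T)) (ℤ.- + (d x ℕ.⊓ T))))
    ... | no  d≰ | no  e≰ rewrite ⊓-step-> d≰ | ⊓-step-> e≰ =
      trans (cong (ℤ._+ _) (lookup-𝟙-∉ (d≰ ∘ ∈⟦⟧⁻ (d? T) ∘ Subset.p∩q⊆p ⟦ d? T ⟧ _)))
        (solve 2 (λ e d → con 0ℤ :+ (e :- d) := (con 1ℤ :+ e) :- (con 1ℤ :+ d)) refl (+ (e x ℕ.⊓ T)) (+ (d x ℕ.⊓ T)))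
      where open ℤSolver.+-*-Solver using (solve; con; _:=_; _:+_; _:-_)
    ... | no  d≰ | yes e≤ = contradiction (ℕ.≤-trans (⊀-shift (irreflexive x)) e≤) d≰

    truncated-Span : ∀ T → Span ExtenderVector (truncated T)
    truncated-Span zero    = subst (Span ExtenderVector) (lookup-ext λ x → trans (Vec.lookup-replicate x 0ℤ)
      (sym (trans (lookup-truncated 0 x) (cong₂ (λ a b → + a ℤ.- + b) (ℕ.⊓-zeroʳ (e x)) (ℕ.⊓-zeroʳ (d x)))))) []
    truncated-Span (suc T) = subst (Span ExtenderVector)
      (lookup-ext λ x → trans (Vec.lookup-zipWith ℤ._+_ x (layer T) (truncated T))
        (trans (cong (ℤ._+_ (lookup (layer T) x)) (lookup-truncated T x))
          (trans (slice T x) (sym (lookup-truncated (suc T) x)))))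
      (Span-⊕ (cut⇒Span (cut T)) (truncated-Span T))

-- Rounding of real representations

lowerBound : ∀ {n} (f : Fin n → ℤ) → ∃[ B ] ∀ x → 0ℤ ℤ.≤ f x ℤ.+ + B
lowerBound f with upperBound (ℤ.∣_∣ ∘ f)
... | B , ≤B = B , λ x → ℤ.≤-trans (∣i∣+i≥0 (f x)) (ℤ.+-monoʳ-≤ (f x) (ℤ.+≤+ (≤B x)))
  where
  ∣i∣+i≥0 : ∀ i → 0ℤ ℤ.≤ i ℤ.+ + ℤ.∣ i ∣
  ∣i∣+i≥0 (+ k)       = ℤ.+≤+ ℕ.z≤n
  ∣i∣+i≥0 (ℤ.-[1+ k ]) = ℤ.≤-reflexive (sym (ℤ.+-inverseˡ (+ suc k)))

module _ {n : ℕ} {P : IntervalOrder n} (C : CanonicalRepresentation P) where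
  open IntervalOrder P using (_≺_)
  open CanonicalRepresentation C
  open Geometry C
  open ConePoints C

  -- A real representation with integral lengths can be replaced by one with integral
  -- endpoints a and b: with the right endpoints eliminated, its conditions are
  -- difference bounds with integer constants on the left endpoints.
  cone⇒integerRepresentation : ∀ z → IntegralPoint (LengthCone C) z →
    ∃₂ λ (a b : Fin n → ℤ) → (∀ x → b x ≡ a x ℤ.+ (lookup z x ℤ.+ (+ r x ℤ.- + ℓ x)))
      × (∀ {x y} → ¬ x ≺ y → a y ℤ.≤ b x) × (∀ {x y} → x ≺ y → ℤ.suc (b x) ℤ.≤ a y)
  cone⇒integerRepresentation z (v , (ℓ′ , r′ , rep , v≃) , w≃) = a , (λ x → a x ℤ.+ c x) , (λ _ → refl) ,
    (λ {x} {y} x⊀y → a-spec x y (c x) (⊀-bound x⊀y)) , λ {x} {y} x≺y → begin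
      ℤ.suc (a x ℤ.+ c x)
        ≤⟨ ℤ.+-monoʳ-≤ 1ℤ (ℤ.+-monoˡ-≤ (c x) (a-spec y x (ℤ.- ℤ.suc (c x)) (≺-bound x≺y))) ⟩
      ℤ.suc (a y ℤ.+ ℤ.- ℤ.suc (c x) ℤ.+ c x)
        ≡⟨ ℤS.solve 2 (λ a c → ℤS.con 1ℤ ℤS.:+ ((a ℤS.:+ (ℤS.:- (ℤS.con 1ℤ ℤS.:+ c))) ℤS.:+ c) ℤS.:= a) refl (a y) (c x) ⟩
      a y ∎
    where
    open ℤ.≤-Reasoning
    module ℚR = ℚ.≤-Reasoning
    module ℤS = ℤSolver.+-*-Solver
    open ℚSolver.+-*-Solver using (solve; con; _:=_; _:+_; _:-_; _:*_; :-_)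
    open IsRepresentation rep

    c : Fin n → ℤ
    c x = lookup z x ℤ.+ (+ r x ℤ.- + ℓ x)

    -- Rational approximations p, q and V of the right endpoint, the left endpoint and
    -- the length of x, at indices that match the shifts made by real addition, and
    -- the exact canonical length K and coordinate Z.
    p q V K Z : Fin n → ℚ
    p x = seq (r′ x) (5 ℕ.+ n)
    q x = seq (ℓ′ x) (5 ℕ.+ n)
    V x = seq (v x) (4 ℕ.+ n)
    K x = ι (+ r x) ℚ.- ι (+ ℓ x)
    Z x = ι (lookup z x)

    u : ℕ → ℚ
    u k = 2⁻ (k ℕ.+ n) ℚ.+ 2⁻ (k ℕ.+ n)

    rounded = rounding n q
    a = proj₁ rounded
    a-spec = proj₂ rounded

    ι-c : ∀ x → ι (c x) ≡ Z x ℚ.+ K x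
    ι-c x = trans (ι-+ (lookup z x) (+ r x ℤ.- + ℓ x)) (cong (Z x ℚ.+_)
      (trans (ι-+ (+ r x) (ℤ.- + ℓ x)) (cong (ι (+ r x) ℚ.+_) (ι-neg (+ ℓ x)))))

    -- A bound by 2⁻ n, from the non-negative multiple of 2⁻ n that is left over: the
    -- errors below add up to 7/16 and 19/32 of 2⁻ n.
    ≤t : ∀ k → {{ℚ.NonNegative k}} → ∀ {s} → s ℚ.+ k ℚ.* 2⁻ n ≡ 2⁻ n → s ℚ.≤ 2⁻ n
    ≤t k {s} eq = subst₂ ℚ._≤_ (ℚ.+-identityʳ s) eq (ℚ.+-monoʳ-≤ s
      (subst (ℚ._≤ k ℚ.* 2⁻ n) (ℚ.*-zeroʳ k) (ℚ.*-monoˡ-≤-nonNeg k (2⁻-nonNeg n))))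

    ⊀-bound : ∀ {x y} → ¬ x ≺ y → q y ℚ.- q x ℚ.≤ ι (c x) ℚ.+ 2⁻ n
    ⊀-bound {x} {y} x⊀y = ℚR.begin
      q y ℚ.- q x
        ℚR.≡⟨ solve 6 (λ p q q′ V K Z → q′ :- q := (Z :+ K) :+ ((q′ :- p) :+ (((p :- q) :- V) :+ ((V :- K) :- Z))))
               refl (p x) (q x) (q y) (V x) (K x) (Z x) ⟩
      (Z x ℚ.+ K x) ℚ.+ ((q y ℚ.- p x) ℚ.+ (((p x ℚ.- q x) ℚ.- V x) ℚ.+ ((V x ℚ.- K x) ℚ.- Z x)))
        ℚR.≤⟨ ℚ.+-monoʳ-≤ (Z x ℚ.+ K x) (ℚ.+-mono-≤ h₁ (ℚ.+-mono-≤ h₂ h₃)) ⟩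
      (Z x ℚ.+ K x) ℚ.+ (u 5 ℚ.+ (u 4 ℚ.+ u 3))
        ℚR.≤⟨ ℚ.+-monoʳ-≤ (Z x ℚ.+ K x) (≤t (+ 9 ℚ./ 16) (solve 1 (λ t →
                 let t₃ = con ½ :* (con ½ :* (con ½ :* t)) ; t₄ = con ½ :* t₃ ; t₅ = con ½ :* t₄ in
                 ((t₅ :+ t₅) :+ ((t₄ :+ t₄) :+ (t₃ :+ t₃))) :+ con (+ 9 ℚ./ 16) :* t := t) refl (2⁻ n))) ⟩
      (Z x ℚ.+ K x) ℚ.+ 2⁻ n
        ℚR.≡⟨ cong (ℚ._+ 2⁻ n) (ι-c x) ⟨
      ι (c x) ℚ.+ 2⁻ n ℚR.∎
      where
      h₁ : q y ℚ.- p x ℚ.≤ u 5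
      h₁ = ℚ.≮⇒≥ λ lt → x⊀y (Equivalence.from (order x y) (5 ℕ.+ n , lt))
      h₂ : (p x ℚ.- q x) ℚ.- V x ℚ.≤ u 4
      h₂ = proj₂ (v≃ x) (4 ℕ.+ n)
      h₃ : (V x ℚ.- K x) ℚ.- Z x ℚ.≤ u 3
      h₃ = proj₂ (w≃ x) (3 ℕ.+ n)

    ≺-bound : ∀ {x y} → x ≺ y → q x ℚ.- q y ℚ.≤ ι (ℤ.- ℤ.suc (c x)) ℚ.+ 2⁻ n
    ≺-bound {x} {y} x≺y = ℚR.begin
      q x ℚ.- q y
        ℚR.≡⟨ solve 7 (λ p q q′ s V K Z → q :- q′ := (:- (con 1ℚ :+ (Z :+ K)))
                 :+ (((p :+ con 1ℚ) :- s) :+ ((s :- q′) :+ ((V :- (p :- q)) :+ (Z :- (V :- K))))))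
               refl (p x) (q x) (q y) s (V x) (K x) (Z x) ⟩
      (ℚ.- (1ℚ ℚ.+ (Z x ℚ.+ K x))) ℚ.+ (((p x ℚ.+ 1ℚ) ℚ.- s) ℚ.+
        ((s ℚ.- q y) ℚ.+ ((V x ℚ.- (p x ℚ.- q x)) ℚ.+ (Z x ℚ.- (V x ℚ.- K x)))))
        ℚR.≤⟨ ℚ.+-monoʳ-≤ (ℚ.- (1ℚ ℚ.+ (Z x ℚ.+ K x))) (ℚ.+-mono-≤ h₀ (ℚ.+-mono-≤ h₁ (ℚ.+-mono-≤ h₂ h₃))) ⟩
      (ℚ.- (1ℚ ℚ.+ (Z x ℚ.+ K x))) ℚ.+ (u 4 ℚ.+ ((2⁻ (4 ℕ.+ n) ℚ.+ 2⁻ (5 ℕ.+ n)) ℚ.+ (u 4 ℚ.+ u 3)))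
        ℚR.≤⟨ ℚ.+-monoʳ-≤ (ℚ.- (1ℚ ℚ.+ (Z x ℚ.+ K x))) (≤t (+ 13 ℚ./ 32) (solve 1 (λ t →
                 let t₃ = con ½ :* (con ½ :* (con ½ :* t)) ; t₄ = con ½ :* t₃ ; t₅ = con ½ :* t₄ in
                 ((t₄ :+ t₄) :+ ((t₄ :+ t₅) :+ ((t₄ :+ t₄) :+ (t₃ :+ t₃)))) :+ con (+ 13 ℚ./ 32) :* t := t) refl (2⁻ n))) ⟩
      (ℚ.- (1ℚ ℚ.+ (Z x ℚ.+ K x))) ℚ.+ 2⁻ n
        ℚR.≡⟨ cong (ℚ._+ 2⁻ n) (trans (ι-neg (ℤ.suc (c x)))
                (cong ℚ.-_ (trans (ι-+ 1ℤ (c x)) (cong (1ℚ ℚ.+_) (ι-c x))))) ⟨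
      ι (ℤ.- ℤ.suc (c x)) ℚ.+ 2⁻ n ℚR.∎
      where
      s = seq (ℓ′ y) (4 ℕ.+ n)
      h₀ : (p x ℚ.+ 1ℚ) ℚ.- s ℚ.≤ u 4
      h₀ = gap x y x≺y (4 ℕ.+ n)
      h₁ : s ℚ.- q y ℚ.≤ 2⁻ (4 ℕ.+ n) ℚ.+ 2⁻ (5 ℕ.+ n)
      h₁ = regular (ℓ′ y) (4 ℕ.+ n) (5 ℕ.+ n)
      h₂ : V x ℚ.- (p x ℚ.- q x) ℚ.≤ u 4
      h₂ = proj₁ (v≃ x) (4 ℕ.+ n)
      h₃ : Z x ℚ.- (V x ℚ.- K x) ℚ.≤ u 3
      h₃ = proj₁ (w≃ x) (3 ℕ.+ n)

  -- Integral endpoints differ from the canonical ones by a weakly increasing shift,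
  -- because consecutive canonical levels are also at distance at least one in the given
  -- representation. A constant B makes the shift non-negative.
  integerRepresentation⇒shift : ∀ z (a b : Fin n → ℤ) →
    (∀ x → b x ≡ a x ℤ.+ (lookup z x ℤ.+ (+ r x ℤ.- + ℓ x))) →
    (∀ {x y} → ¬ x ≺ y → a y ℤ.≤ b x) → (∀ {x y} → x ≺ y → ℤ.suc (b x) ℤ.≤ a y) →
    ∃₂ λ d e → IsShift d e × ∀ x → lookup z x ℤ.+ + d x ≡ + e x
  integerRepresentation⇒shift z a b b-spec ⊀-ab ≺-ab =
    d , e , record { ⊀-shift = ⊀-shift ; ≺-shift = ≺-shift } , value
    where
    open ℤ.≤-Reasoning
    open ℤSolver.+-*-Solver using (solve; con; _:=_; _:+_; _:-_)

    -- If one endpoint is after another one in the canonical representation, then in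
    -- the given one it is after it by at least the same distance. The induction goes
    -- through the intermediate levels.
    ⊀-spread : ∀ k {x y} → ℓ y ℕ.+ k ≡ r x → a y ℤ.+ + k ℤ.≤ b x
    ⊀-spread zero {x} {y} eq = begin
      a y ℤ.+ 0ℤ ≡⟨ ℤ.+-identityʳ (a y) ⟩
      a y        ≤⟨ ⊀-ab (≤⇒⊀ (ℕ.m+n≤o⇒m≤o (ℓ y) (ℕ.≤-reflexive eq))) ⟩
      b x        ∎
    ⊀-spread (suc k) {x} {y} eq = let
        ℓ+k<r = ℕ.≤-reflexive (trans (sym (ℕ.+-suc (ℓ y) k)) eq)
        w , rw≡ = rightLevel {ℓ y ℕ.+ k} (ℕ.<-trans ℓ+k<r (r<m x))
        w′ , ℓw′≡ = leftLevel (r<m x)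
      in begin
      a y ℤ.+ + suc k          ≡⟨ solve 2 (λ a k → a :+ (con 1ℤ :+ k) := con 1ℤ :+ (a :+ k)) refl (a y) (+ k) ⟩
      ℤ.suc (a y ℤ.+ + k)      ≤⟨ ℤ.suc-mono (⊀-spread k (sym rw≡)) ⟩
      ℤ.suc (b w)              ≤⟨ ≺-ab (<⇒≺ (subst₂ ℕ._<_ (sym rw≡) (sym ℓw′≡) ℓ+k<r)) ⟩
      a w′                     ≤⟨ ⊀-ab (≤⇒⊀ (ℕ.≤-reflexive ℓw′≡)) ⟩
      b x                      ∎

    ≺-spread : ∀ k {x y} → r x ℕ.+ suc k ≡ ℓ y → b x ℤ.+ + suc k ℤ.≤ a y
    ≺-spread zero {x} {y} eq = begin
      b x ℤ.+ 1ℤ  ≡⟨ ℤ.+-comm (b x) 1ℤ ⟩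
      ℤ.suc (b x) ≤⟨ ≺-ab (<⇒≺ (ℕ.≤-reflexive (trans (ℕ.+-comm 1 (r x)) eq))) ⟩
      a y         ∎
    ≺-spread (suc k) {x} {y} eq = let
        r+k<ℓ = ℕ.≤-reflexive (trans (sym (ℕ.+-suc (r x) (suc k))) eq)
        r+k<m = ℕ.<-trans r+k<ℓ (ℓ<m y)
        w , ℓw≡ = leftLevel {r x ℕ.+ suc k} r+k<m
        w′ , rw′≡ = rightLevel {r x ℕ.+ suc k} r+k<m
      in begin
      b x ℤ.+ + suc (suc k)     ≡⟨ solve 2 (λ b k → b :+ (con 1ℤ :+ k) := con 1ℤ :+ (b :+ k)) refl (b x) (+ suc k) ⟩
      ℤ.suc (b x ℤ.+ + suc k)   ≤⟨ ℤ.suc-mono (≺-spread k (sym ℓw≡)) ⟩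
      ℤ.suc (a w)               ≤⟨ ℤ.suc-mono (⊀-ab (≤⇒⊀ (ℕ.≤-reflexive (trans ℓw≡ (sym rw′≡))))) ⟩
      ℤ.suc (b w′)              ≤⟨ ≺-ab (<⇒≺ (subst (ℕ._< ℓ y) (sym rw′≡) r+k<ℓ)) ⟩
      a y                       ∎

    B = proj₁ (lowerBound (λ x → a x ℤ.- + ℓ x))
    dᶻ eᶻ : Fin n → ℤ
    dᶻ x = a x ℤ.- + ℓ x ℤ.+ + B
    eᶻ x = b x ℤ.- + r x ℤ.+ + B
    d e : Fin n → ℕ
    d x = ℤ.∣ dᶻ x ∣
    e x = ℤ.∣ eᶻ x ∣

    ⊀ᶻ : ∀ {x y} → ¬ x ≺ y → dᶻ y ℤ.≤ eᶻ x
    ⊀ᶻ {x} {y} x⊀y = let k , eq = ℕ.m≤n⇒∃[o]m+o≡n (⊀⇒≤ x⊀y) in ℤ.+-monoˡ-≤ (+ B) (begin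
      a y ℤ.- + ℓ y                         ≡⟨ solve 3 (λ a ℓ k → a :- ℓ := (a :+ k) :- (ℓ :+ k)) refl (a y) (+ ℓ y) (+ k) ⟩
      (a y ℤ.+ + k) ℤ.- (+ (ℓ y ℕ.+ k))     ≡⟨ cong (λ i → (a y ℤ.+ + k) ℤ.- + i) eq ⟩
      (a y ℤ.+ + k) ℤ.- + r x               ≤⟨ ℤ.+-monoˡ-≤ (ℤ.- + r x) (⊀-spread k eq) ⟩
      b x ℤ.- + r x                         ∎)

    ≺ᶻ : ∀ {x y} → x ≺ y → eᶻ x ℤ.≤ dᶻ y
    ≺ᶻ {x} {y} x≺y = let k , eq′ = ℕ.m≤n⇒∃[o]m+o≡n (≺⇒< x≺y) ; eq = trans (ℕ.+-suc (r x) k) eq′ in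
      ℤ.+-monoˡ-≤ (+ B) (begin
      b x ℤ.- + r x
        ≡⟨ solve 3 (λ b r k → b :- r := (b :+ k) :- (r :+ k)) refl (b x) (+ r x) (+ suc k) ⟩
      (b x ℤ.+ + suc k) ℤ.- (+ (r x ℕ.+ suc k)) ≡⟨ cong (λ i → (b x ℤ.+ + suc k) ℤ.- + i) eq ⟩
      (b x ℤ.+ + suc k) ℤ.- + ℓ y               ≤⟨ ℤ.+-monoˡ-≤ (ℤ.- + ℓ y) (≺-spread k eq) ⟩
      a y ℤ.- + ℓ y                             ∎)

    +d : ∀ x → + d x ≡ dᶻ x
    +d x = ℤ.0≤i⇒+∣i∣≡i (proj₂ (lowerBound (λ x → a x ℤ.- + ℓ x)) x)

    +e : ∀ x → + e x ≡ eᶻ x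
    +e x = ℤ.0≤i⇒+∣i∣≡i (ℤ.≤-trans (proj₂ (lowerBound (λ x → a x ℤ.- + ℓ x)) x) (⊀ᶻ (irreflexive x)))

    ⊀-shift : ∀ {x y} → ¬ x ≺ y → d y ℕ.≤ e x
    ⊀-shift {x} {y} x⊀y = ℤ.drop‿+≤+ (subst₂ ℤ._≤_ (sym (+d y)) (sym (+e x)) (⊀ᶻ x⊀y))

    ≺-shift : ∀ {x y} → x ≺ y → e x ℕ.≤ d y
    ≺-shift {x} {y} x≺y = ℤ.drop‿+≤+ (subst₂ ℤ._≤_ (sym (+e x)) (sym (+d y)) (≺ᶻ x≺y))

    value : ∀ x → lookup z x ℤ.+ + d x ≡ + e x
    value x = begin-equality
      lookup z x ℤ.+ + d x ≡⟨ cong (ℤ._+_ (lookup z x)) (+d x) ⟩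
      lookup z x ℤ.+ (a x ℤ.- + ℓ x ℤ.+ + B)
        ≡⟨ solve 5 (λ z a ℓ r B → z :+ ((a :- ℓ) :+ B) := (a :+ (z :+ (r :- ℓ))) :- r :+ B) refl
             (lookup z x) (a x) (+ ℓ x) (+ r x) (+ B) ⟩
      (a x ℤ.+ (lookup z x ℤ.+ (+ r x ℤ.- + ℓ x))) ℤ.- + r x ℤ.+ + B ≡⟨ cong (λ i → i ℤ.- + r x ℤ.+ + B) (b-spec x) ⟨
      eᶻ x ≡⟨ +e x ⟨
      + e x ∎

  -- Every integral point of the cone is a sum of characteristic vectors of
  -- fundamental extenders.
  cone⇒Span : ∀ {z} → IntegralPoint (LengthCone C) z → Span ExtenderVector z
  cone⇒Span {z} z∈ =
    let a , b , b-spec , ⊀-ab , ≺-ab = cone⇒integerRepresentation z z∈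
        d , e , shift , eq = integerRepresentation⇒shift z a b b-spec ⊀-ab ≺-ab in shift⇒Span shift z eq

-- The minimal Hilbert basis

⊆∧≢⇒⊂ : ∀ {n} {S T : Subset n} → S ⊆ T → S ≢ T → S ⊂ T
⊆∧≢⇒⊂ {S = S} {T} S⊆T S≢T with Subset.nonempty? (T ∩ ∁ S)
... | yes (x , x∈) = S⊆T , x , Subset.p∩q⊆p T (∁ S) x∈ , Subset.x∈∁p⇒x∉p (Subset.p∩q⊆q T (∁ S) x∈)
... | no  none     = contradiction (Subset.⊆-antisym S⊆T λ {x} x∈T → decidable-stable (x Subset.∈? S) λ x∉S →
                       none (x , Subset.x∈p∩q⁺ (x∈T , Subset.x∉p⇒x∈∁p x∉S))) S≢T

module _ {n : ℕ} {P : IntervalOrder n} (C : CanonicalRepresentation P) where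
  open ConePoints C

  private
    Cone : Pred (Vec ℤ n) 0ℓ
    Cone = IntegralPoint (LengthCone C)

    Extender Decomposable : Pred (Subset n) 0ℓ
    Extender     = IsFundamentalExtender C
    Decomposable = IsDisjointUnionOfProperExtenders C

  extender? : Decidable Extender
  extender? S = Subset.nonempty? S ×-dec map′
    (λ { (i , i< , Z , p) → i , Z , ℕ.≤-pred i< , p })
    (λ { (i , Z , i≤ , p) → i , ℕ.s≤s i≤ , Z , p })
    (ℕ.anyUpTo? (λ i → Subset.anySubset? λ Z →
        ((Z Subset.⊆? leftBorderline C i) ⊎-dec (Z Subset.⊆? rightBorderline C i))
        ×-dec Vec.≡-dec Bool._≟_ S (gapSet C i ∪ Z))
      (suc (magnitude P)))

  -- The sets in a disjoint union are nonempty, so at most n of them are needed.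
  decomposable? : Decidable Decomposable
  decomposable? S = map′ (λ (Ts , _ , p) → Ts , p)
    (λ { (Ts , es , ds , eq) →
         Ts , ℕ.≤-trans (length≤∣⋃∣ (All.map (proj₁ ∘ proj₁) es) ds) (Subset.∣p∣≤n (⋃ Ts)) , es , ds , eq })
    (anyBounded? n λ Ts → All.all? (λ T → extender? T ×-dec (T Subset.⊂? S)) Ts
      ×-dec (AllPairs.allPairs? (λ T U → ¬? (Subset.nonempty? (T ∩ U))) Ts
      ×-dec Vec.≡-dec Bool._≟_ (⋃ Ts) S))

  cone-nonNeg : ∀ z → Cone z → NonNeg z
  cone-nonNeg z z∈ = Span-nonNeg (λ { (U , _ , refl) → 𝟙-nonNeg U }) (cone⇒Span C {z} z∈)

  basis⇒Span : ∀ {H} → IsHilbertBasis (LengthCone C) H → ∀ {z} → Cone z → Span (List._∈ H) z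
  basis⇒Span {H} basis {z} z∈ with IsHilbertBasis.generates basis z z∈
  ... | c , refl = combination⇒Span c H

  -- If S is a disjoint union of proper extenders, then these are sums of basis vectors
  -- other than that of S, so the latter can be removed from the basis.
  hilbert⇒indecomposable : ∀ {S} → IsHilbertSet C S → ¬ Decomposable S
  hilbert⇒indecomposable {S} (_ , H , isMin , S∈H) (Ts , es , ds , ⋃≡S) =
    proj₂ (∈-filter (List.∈-deduplicate⁻ _≟ᵛ_ _
      (minimal H′ basis′ (proj₁ ∘ ∈-filter ∘ List.∈-deduplicate⁻ _≟ᵛ_ _) S∈H))) refl
    where
    open IsMinimalHilbertBasis isMin

    other? : Decidable (_≢ 𝟙 S)
    other? h = ¬? (h ≟ᵛ 𝟙 S)

    -- Duplicates are removed as well, since combination needs a list without them.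
    H′ : List (Vec ℤ n)
    H′ = List.deduplicate _≟ᵛ_ (List.filter other? H)

    ∈-filter : ∀ {h} → h List.∈ List.filter other? H → h List.∈ H × h ≢ 𝟙 S
    ∈-filter = List.∈-filter⁻ other? {xs = H}

    ∈H′⁺ : ∀ {h} → h List.∈ H × h ≢ 𝟙 S → h List.∈ H′
    ∈H′⁺ (h∈H , h≢) = List.∈-deduplicate⁺ _≟ᵛ_ (List.∈-filter⁺ other? h∈H h≢)

    H∈cone : ∀ {h} → h List.∈ H → Cone h
    H∈cone = All.lookup (IsHilbertBasis.inCone isHilbertBasis)

    part-Span : ∀ {T} → Extender T × T ⊂ S → Span (List._∈ H′) (𝟙 T)
    part-Span (ext , _ , x , x∈S , x∉T) = Span-bind (Span-single ∘ ∈H′⁺)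
      (Span-avoid (λ {h} h∈H → cone-nonNeg h (H∈cone h∈H)) x
        (subst₂ ℤ._<_ (sym (lookup-𝟙-∉ x∉T)) (sym (lookup-𝟙-∈ x∈S)) (ℤ.+<+ (ℕ.s≤s ℕ.z≤n)))
        (basis⇒Span isHilbertBasis (extender⇒cone ext)))

    S-Span : Span (List._∈ H′) (𝟙 S)
    S-Span = subst (Span (List._∈ H′) ∘ 𝟙) ⋃≡S (Span-𝟙-⋃ (All.map part-Span es) ds)

    H-Span : ∀ {h} → h List.∈ H → Span (List._∈ H′) h
    H-Span {h} h∈H with h ≟ᵛ 𝟙 S
    ... | yes refl = S-Span
    ... | no  h≢   = Span-single (∈H′⁺ (h∈H , h≢))

    basis′ : IsHilbertBasis (LengthCone C) H′
    basis′ = record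
      { inCone    = All.tabulate (H∈cone ∘ proj₁ ∘ ∈-filter ∘ List.∈-deduplicate⁻ _≟ᵛ_ _)
      ; generates = λ z z∈ → Span⇒combination (deduplicate-! _≟ᵛ_ _) (Span-bind H-Span (basis⇒Span isHilbertBasis z∈))
      }

  private
    indecomposable? : Decidable (λ T → Extender T × ¬ Decomposable T)
    indecomposable? T = extender? T ×-dec ¬? (decomposable? T)

  -- The characteristic vectors of the fundamental extenders that are not disjoint
  -- unions of smaller ones.
  indecomposables : List (Vec ℤ n)
  indecomposables = List.deduplicate _≟ᵛ_ (List.map 𝟙 (List.filter indecomposable? (subsets n)))

  ∈indecomposables⁺ : ∀ {T} → Extender T → ¬ Decomposable T → 𝟙 T List.∈ indecomposables
  ∈indecomposables⁺ {T} ext ¬dec = List.∈-deduplicate⁺ _≟ᵛ_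
    (List.∈-map⁺ 𝟙 (List.∈-filter⁺ indecomposable? (∈-subsets T) (ext , ¬dec)))

  ∈indecomposables⁻ : ∀ {h} → h List.∈ indecomposables → ∃[ T ] (Extender T × ¬ Decomposable T) × h ≡ 𝟙 T
  ∈indecomposables⁻ h∈ =
    let T , T∈ , eq = List.∈-map⁻ 𝟙 (List.∈-deduplicate⁻ _≟ᵛ_ _ h∈)
    in T , proj₂ (List.∈-filter⁻ indecomposable? {xs = subsets n} T∈) , eq

  -- By induction on the size of the extender, bounded by k.
  extender-Span : ∀ k {T} → ∣ T ∣ ℕ.< k → Extender T → Span (List._∈ indecomposables) (𝟙 T)
  extender-Span (suc k) {T} ∣T∣<k ext = case (decomposable? T)
    where
    case : Dec (Decomposable T) → Span (List._∈ indecomposables) (𝟙 T)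
    case (no ¬dec) = Span-single (∈indecomposables⁺ ext ¬dec)
    case (yes (Ts , es , ds , ⋃≡T)) = subst (Span (List._∈ indecomposables) ∘ 𝟙) ⋃≡T
      (Span-𝟙-⋃ (All.map (λ (ext′ , U⊂T) →
        extender-Span k (ℕ.<-≤-trans (Subset.p⊂q⇒∣p∣<∣q∣ U⊂T) (ℕ.≤-pred ∣T∣<k)) ext′) es) ds)

  indecomposables-basis : IsHilbertBasis (LengthCone C) indecomposables
  indecomposables-basis = record
    { inCone    = All.tabulate λ h∈ → let T , (ext , _) , eq = ∈indecomposables⁻ h∈ in
                    subst Cone (sym eq) (extender⇒cone ext)
    ; generates = λ z z∈ → Span⇒combination (deduplicate-! _≟ᵛ_ _)
                    (Span-bind (λ { (T , ext , refl) → extender-Span _ (ℕ.n<1+n _) ext }) (cone⇒Span C {z} z∈))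
    }

  -- A basis within the indecomposables writes the vector of an indecomposable T as a
  -- sum; if T itself did not occur, the sum would give a disjoint union.
  indecomposables-minimal : IsMinimalHilbertBasis (LengthCone C) indecomposables
  indecomposables-minimal = record { isHilbertBasis = indecomposables-basis ; minimal = minimal }
    where
    minimal : ∀ H → IsHilbertBasis (LengthCone C) H → H List.⊆ indecomposables → indecomposables List.⊆ H
    minimal H basis H⊆ {h} h∈ = decidable-stable (Any.any? (h ≟ᵛ_) H) (absurd h (∈indecomposables⁻ h∈))
      where
      absurd : ∀ h → ∃[ T ] (Extender T × ¬ Decomposable T) × h ≡ 𝟙 T → ¬ ¬ h List.∈ H
      absurd h (T , (ext , ¬dec) , refl) T∉H =
        let Ts , es , ds , ⋃≡T = Span⇒⋃ {E = λ U → Extender U × U ≢ T}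
              (Span-bind (λ h∈H → let U , (ext , _) , eq = ∈indecomposables⁻ (H⊆ h∈H) in
                  Span-single (U , (ext , λ U≡T → T∉H (subst (List._∈ H) (trans eq (cong 𝟙 U≡T)) h∈H)) , eq))
                (basis⇒Span basis (extender⇒cone ext))) refl
        in ¬dec (Ts , All.tabulate (λ U∈ → let ext , U≢T = All.lookup es U∈ in
                   ext , ⊆∧≢⇒⊂ (subst (_ ⊆_) ⋃≡T (⊆⋃ U∈)) U≢T) , ds , ⋃≡T)

theorem6p2 : ∀ {n : ℕ} (P : IntervalOrder n) (C : CanonicalRepresentation P) (S : Subset n) →
    IsFundamentalExtender C S →
    IsHilbertSet C S ⇔ (¬ IsDisjointUnionOfProperExtenders C S)
theorem6p2 P C S ext = mk⇔ (hilbert⇒indecomposable C) λ ¬dec →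
  ext , indecomposables C , indecomposables-minimal C , ∈indecomposables⁺ C ext ¬dec
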